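{- Let $m$ and $n$ be positive integers. For a non-negative integer $k$ define the polynomials $$d_k(x)=\sum_{i=0}^k\binom{k}{i}\binom{x}{i}2^i,\qquad s_k(x)=\sum_{i=0}^k\binom{k}{i}\binom{x}{i}\binom{x+i}{i}.$$ Then each of the polynomials \begin{align*} &\frac{x(x+1)}{2n^2}\sum_{k=0}^{n-1}(2k+1)d_k(x)^2,\quad \frac{1}{n}\sum_{k=0}^{n-1}(2k+1)d_k(x)^{2m},\quad \frac{1}{n}\sum_{k=0}^{n-1}(-1)^k(2k+1)d_k(x)^{2m}, \\ &\frac{1}{n^2}\sum_{k=0}^{n-1}(2k+1)s_k(x)^2,\quad \frac{1}{n}\sum_{k=0}^{n-1}(2k+1)s_k(x)^{2m},\quad \frac{1}{n}\sum_{k=0}^{n-1}(-1)^k(2k+1)s_k(x)^{2m} \end{align*} is integer-valued.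
   Context: Here $\binom{x}{i}=x(x-1)\cdots(x-i+1)/i!$ is a polynomial in $x$. A polynomial $P(x)$ with real coefficients is called integer-valued if $P(x)\in\mathbb{Z}$ for all $x\in\mathbb{Z}$. -}

module Defs where

open import Data.Nat as ℕ using (ℕ; zero; suc; _!; NonZero)
open import Data.Nat.Properties using (_!≢0)
open import Data.Nat.Combinatorics using (_C_)
open import Data.Integer as ℤ using (ℤ; +_)
open import Data.Product using (∃)
open import Relation.Binary.PropositionalEquality using (_≡_)
open import Data.Rational using (ℚ; _/_; _+_; _*_; _-_; -_; 0ℚ; 1ℚ)

ℤ→ℚ : ℤ → ℚ
ℤ→ℚ z = z / 1

ℕ→ℚ : ℕ → ℚ
ℕ→ℚ n = (+ n) / 1

_^ℚ_ : ℚ → ℕ → ℚ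
p ^ℚ zero  = 1ℚ
p ^ℚ suc k = p * (p ^ℚ k)

Σ< : ℕ → (ℕ → ℚ) → ℚ
Σ< zero    f = 0ℚ
Σ< (suc n) f = Σ< n f + f n

falling : ℚ → ℕ → ℚ
falling x zero    = 1ℚ
falling x (suc i) = falling x i * (x - ℕ→ℚ i)

binom : ℚ → ℕ → ℚ
binom x i = falling x i * ((+ 1) / (i !)) {{i !≢0}}

d : ℕ → ℚ → ℚ
d k x = Σ< (suc k) (λ i → ℕ→ℚ (k C i) * binom x i * (ℕ→ℚ 2 ^ℚ i))

s : ℕ → ℚ → ℚ
s k x = Σ< (suc k) (λ i → ℕ→ℚ (k C i) * binom x i * binom (x + ℕ→ℚ i) i)

sgn : ℕ → ℚ
sgn k = (- 1ℚ) ^ℚ k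

IntegerValued : (ℚ → ℚ) → Set
IntegerValued P = ∀ (x : ℤ) → ∃ λ (z : ℤ) → P (ℤ→ℚ x) ≡ ℤ→ℚ z

P1 : (n : ℕ) → .{{NonZero n}} → ℚ → ℚ
P1 n x = (x * (x + 1ℚ)) * ((+ 1) / 2) * ((+ 1) / n) * ((+ 1) / n)
         * Σ< n (λ k → ℕ→ℚ (2 ℕ.* k ℕ.+ 1) * (d k x ^ℚ 2))

P2 : (m n : ℕ) → .{{NonZero n}} → ℚ → ℚ
P2 m n x = ((+ 1) / n) * Σ< n (λ k → ℕ→ℚ (2 ℕ.* k ℕ.+ 1) * (d k x ^ℚ (2 ℕ.* m)))

P3 : (m n : ℕ) → .{{NonZero n}} → ℚ → ℚ
P3 m n x = ((+ 1) / n) * Σ< n (λ k → sgn k * ℕ→ℚ (2 ℕ.* k ℕ.+ 1) * (d k x ^ℚ (2 ℕ.* m)))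

P4 : (n : ℕ) → .{{NonZero n}} → ℚ → ℚ
P4 n x = ((+ 1) / n) * ((+ 1) / n) * Σ< n (λ k → ℕ→ℚ (2 ℕ.* k ℕ.+ 1) * (s k x ^ℚ 2))

P5 : (m n : ℕ) → .{{NonZero n}} → ℚ → ℚ
P5 m n x = ((+ 1) / n) * Σ< n (λ k → ℕ→ℚ (2 ℕ.* k ℕ.+ 1) * (s k x ^ℚ (2 ℕ.* m)))

P6 : (m n : ℕ) → .{{NonZero n}} → ℚ → ℚ
P6 m n x = ((+ 1) / n) * Σ< n (λ k → sgn k * ℕ→ℚ (2 ℕ.* k ℕ.+ 1) * (s k x ^ℚ (2 ℕ.* m)))

{-# OPTIONS --safe #-}

-- Put bᵢ(k) = C(k,i) C(k+i,i), and let ν = x or ν = −1 − x be the natural number with ν(ν+1) = x(x+1).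
-- The squares are integral combinations of the bᵢ(k):
--
--   d_k(x)² = Σᵢ bᵢ(k) 4ⁱ C(ν+i,2i),     s_k(x)² = Σᵢ bᵢ(k) C(2i,i) Σⱼ C(i,j) b_{i+j}(ν).
--
-- Both follow from the three-term recurrences in k of d_k and s_k: these turn into a first-order recurrence
-- for the pair (square, product of neighbours), for which the product k d_k d_{k−1}, respectively
-- k² s_k s_{k−1}, has a similar closed form, so that it remains to check a telescoping sum over i.
--
-- Since bᵢ bⱼ = Σₗ C(l,i) C(l,j) C(i+j,l) bₗ, the span of the bᵢ is a ring and contains all even powers.
-- The theorem is then a consequence of
--
--   (i+1) Σ_{k<n} (2k+1) bᵢ(k) = n (n−i) bᵢ(n),     Σ_{k<n} (−1)ᵏ (2k+1) bᵢ(k) = (−1)ⁿ⁻¹ (n−i) bᵢ(n)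
--
-- and (n−i) C(n,i) = n C(n−1,i) = (i+1) C(n,i+1). For the divisibility by n² the denominator i+1 is absorbed
-- by C(2i,i), respectively by x(x+1) C(ν+i,2i).

module Submission where

open import Defs
open import Data.Nat using (ℕ; NonZero)
open import Data.Product using (_×_)

open import Data.Integer using (ℤ; +_; -[1+_]; _+_; _*_; _-_; -_; _^_; 0ℤ; 1ℤ)
open import Data.Integer.Properties using
  ( +-comm; +-identityˡ; +-identityʳ; +-inverseʳ; i-j≡0⇒i≡j; *-comm; *-assoc; *-identityˡ; *-identityʳ
  ; *-zeroˡ; *-zeroʳ; *-distribˡ-+; *-distribʳ-+; *-cancelˡ-≡; pos-*; ^-*-assoc)
open import Data.Integer.Tactic.RingSolver using (solve; solve-∀)
open import Data.List using ([]; _∷_)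
open import Data.Nat as ℕ using (zero; suc; pred; _!)
open import Data.Nat.Combinatorics using (_C_; nCn≡1; nCk≡nC[n∸k]; k>n⇒nCk≡0; nCk+nC[k+1]≡[n+1]C[k+1])
import Data.Nat.Properties as ℕ
open import Data.Product using (∃; _,_; proj₁; proj₂)
open import Data.Rational as ℚ using (ℚ; 1ℚ; toℚᵘ)
import Data.Rational.Properties as ℚ
open import Data.Rational.Solver using (module +-*-Solver)
open import Data.Rational.Unnormalised as ℚᵘ using (mkℚᵘ; *≡*)
import Data.Rational.Unnormalised.Properties as ℚᵘ
open import Relation.Binary.PropositionalEquality
import Relation.Binary.Reasoning.Setoid as SetoidReasoning

-- Polynomial identities modulo equational hypotheses are proved by exhibiting
-- a − b as a combination Σ qᵢ (lᵢ − rᵢ) of the hypotheses lᵢ ≡ rᵢ.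

infixl 4 _⊞_·_

_⊞_·_ : ∀ {p} → p ≡ 0ℤ → ∀ q {l r} → l ≡ r → p + q * (l - r) ≡ 0ℤ
_⊞_·_ refl q {l} refl = trans (+-identityˡ _) (trans (cong (q *_) (+-inverseʳ l)) (*-zeroʳ q))

by : ∀ {a b p} → p ≡ 0ℤ → a - b ≡ p → a ≡ b
by refl e = i-j≡0⇒i≡j _ _ e

-- Finite sums and telescoping

∑ : ℕ → (ℕ → ℤ) → ℤ
∑ zero    f = 0ℤ
∑ (suc n) f = ∑ n f + f n

∑-cong< : ∀ n {f g} → (∀ i → i ℕ.< n → f i ≡ g i) → ∑ n f ≡ ∑ n g
∑-cong< zero    f≡g = refl
∑-cong< (suc n) f≡g = cong₂ _+_ (∑-cong< n λ i i<n → f≡g i (ℕ.m<n⇒m<1+n i<n)) (f≡g n ℕ.≤-refl)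

∑-cong : ∀ n {f g} → (∀ i → f i ≡ g i) → ∑ n f ≡ ∑ n g
∑-cong n f≡g = ∑-cong< n λ i _ → f≡g i

∑-zero : ∀ n {f} → (∀ i → f i ≡ 0ℤ) → ∑ n f ≡ 0ℤ
∑-zero zero    f≡0 = refl
∑-zero (suc n) f≡0 = cong₂ _+_ (∑-zero n f≡0) (f≡0 n)

∑-+ : ∀ n f g → ∑ n f + ∑ n g ≡ ∑ n (λ i → f i + g i)
∑-+ zero    f g = refl
∑-+ (suc n) f g = trans (alg (∑ n f) (∑ n g) (f n) (g n)) (cong (_+ (f n + g n)) (∑-+ n f g))
  where
  alg : ∀ a b c d → a + c + (b + d) ≡ a + b + (c + d)
  alg = solve-∀

∑-*ˡ : ∀ n c f → c * ∑ n f ≡ ∑ n (λ i → c * f i)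
∑-*ˡ zero    c f = *-zeroʳ c
∑-*ˡ (suc n) c f = trans (*-distribˡ-+ c (∑ n f) (f n)) (cong (_+ c * f n) (∑-*ˡ n c f))

-- Creative telescoping with certificate `V`: a relation between sums follows from a termwise
-- identity once `V` vanishes at both ends.
∑-telescope : ∀ n (f g V : ℕ → ℤ) → (∀ i → f i + V i ≡ g i + V (suc i)) → V 0 ≡ 0ℤ → V n ≡ 0ℤ → ∑ n f ≡ ∑ n g
∑-telescope n f g V step V₀ Vₙ = by (refl ⊞ 1ℤ · go n ⊞ - 1ℤ · V₀ ⊞ 1ℤ · Vₙ) (alg (∑ n f) (∑ n g) (V 0) (V n))
  where
  alg : ∀ s t v w → s - t ≡ 0ℤ + 1ℤ * (s + v - (t + w)) + - 1ℤ * (v - 0ℤ) + 1ℤ * (w - 0ℤ)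
  alg = solve-∀
  algˢ : ∀ s t v w w′ a b → s + a + v - (t + b + w′) ≡ 0ℤ + 1ℤ * (s + v - (t + w)) + 1ℤ * (a + w - (b + w′))
  algˢ = solve-∀
  go : ∀ m → ∑ m f + V 0 ≡ ∑ m g + V m
  go zero    = refl
  go (suc m) = by (refl ⊞ 1ℤ · go m ⊞ 1ℤ · step m) (algˢ (∑ m f) (∑ m g) (V 0) (V m) (V (suc m)) (f m) (g m))

∑-head : ∀ n f → (∀ i → f (suc i) ≡ 0ℤ) → ∑ (suc n) f ≡ f 0
∑-head zero    f f≡0 = +-identityˡ _
∑-head (suc n) f f≡0 = trans (cong₂ _+_ (∑-head n f f≡0) (f≡0 n)) (+-identityʳ _)

∑-extend : ∀ {m n} f → m ℕ.≤′ n → (∀ i → m ℕ.≤ i → f i ≡ 0ℤ) → ∑ n f ≡ ∑ m f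
∑-extend f ℕ.≤′-refl       f≡0 = refl
∑-extend f (ℕ.≤′-step m≤n) f≡0 =
  trans (cong₂ _+_ (∑-extend f m≤n f≡0) (f≡0 _ (ℕ.≤′⇒≤ m≤n))) (+-identityʳ _)

∑-swap : ∀ m n (f : ℕ → ℕ → ℤ) → ∑ m (λ i → ∑ n (f i)) ≡ ∑ n (λ j → ∑ m (λ i → f i j))
∑-swap zero    n f = sym (∑-zero n λ _ → refl)
∑-swap (suc m) n f = trans (cong (_+ ∑ n (f m)) (∑-swap m n f)) (∑-+ n _ (f m))

-- `1ℤ + + k` evaluates to `+ suc k`. This form is used throughout, since replacing `+ k` by an
-- integer variable then leaves a polynomial identity.
cancel : ∀ k {a b} → (1ℤ + + k) * a ≡ (1ℤ + + k) * b → a ≡ b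
cancel k = *-cancelˡ-≡ (+ suc k) _ _

cancel² : ∀ k {a b} → (1ℤ + + k) * (1ℤ + + k) * a ≡ (1ℤ + + k) * (1ℤ + + k) * b → a ≡ b
cancel² k {a} {b} eq = cancel k (cancel k (trans (sym (*-assoc (1ℤ + + k) (1ℤ + + k) a))
  (trans eq (*-assoc (1ℤ + + k) (1ℤ + + k) b))))

-- Binomial coefficients

opaque

  -- Integer values let the ratio relations use true differences such as `+ n - + k`, also for
  -- `k > n`. Opacity keeps the coefficients atomic.
  bin : ℕ → ℕ → ℤ
  bin n k = + (n C k)

  bin-C : ∀ n k → bin n k ≡ + (n C k)
  bin-C n k = refl

  bin-zero : ∀ n → bin n 0 ≡ 1ℤ
  bin-zero n = cong +_ (trans (nCk≡nC[n∸k] {0} {n} ℕ.z≤n) (nCn≡1 n))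

  bin-self : ∀ n → bin n n ≡ 1ℤ
  bin-self n = cong +_ (nCn≡1 n)

  bin-< : ∀ {n k} → n ℕ.< k → bin n k ≡ 0ℤ
  bin-< n<k = cong +_ (k>n⇒nCk≡0 n<k)

  bin-pascal : ∀ n k → bin (suc n) (suc k) ≡ bin n k + bin n (suc k)
  bin-pascal n k = cong +_ (sym (nCk+nC[k+1]≡[n+1]C[k+1] n k))

-- Induction on `n` through Pascal's rule. Up to boundary cases, the other ratio relations are
-- linear consequences of this one and of Pascal's rule.
bin-absorb : ∀ n k → (1ℤ + + k) * bin (suc n) (suc k) ≡ (1ℤ + + n) * bin n k
bin-absorb zero zero = cong (1ℤ *_)
  (trans (bin-pascal 0 0) (trans (cong (λ z → bin 0 0 + z) (bin-< {0} {1} (ℕ.s≤s ℕ.z≤n))) (+-identityʳ _)))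
bin-absorb zero (suc k) = trans
  (trans (cong ((1ℤ + + suc k) *_) (bin-< {1} {suc (suc k)} (ℕ.s≤s (ℕ.s≤s ℕ.z≤n)))) (*-zeroʳ (1ℤ + + suc k)))
  (sym (cong (1ℤ *_) (bin-< {0} {suc k} (ℕ.s≤s ℕ.z≤n))))
bin-absorb (suc n) zero =
  alg (+ n) (bin (suc (suc n)) 1) (bin (suc n) 0) (bin (suc n) 1) (bin n 0)
    (bin-pascal (suc n) 0) (bin-absorb n 0) (trans (bin-zero (suc n)) (sym (bin-zero n)))
  where
  alg : ∀ n a b c d → a ≡ b + c → (1ℤ + 0ℤ) * c ≡ (1ℤ + n) * d → b ≡ d →
        (1ℤ + 0ℤ) * a ≡ (1ℤ + (1ℤ + n)) * b
  alg n a b c d p q r = by (refl ⊞ 1ℤ · p ⊞ 1ℤ · q ⊞ - (1ℤ + n) · r) (solve (n ∷ a ∷ b ∷ c ∷ d ∷ []))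
bin-absorb (suc n) (suc k) =
  alg (+ n) (+ k) (bin (suc (suc n)) (suc (suc k))) (bin (suc n) (suc k)) (bin (suc n) (suc (suc k)))
    (bin n k) (bin n (suc k)) (bin-pascal (suc n) (suc k)) (bin-pascal n k) (bin-absorb n k) (bin-absorb n (suc k))
  where
  alg : ∀ n k a b c d e → a ≡ b + c → b ≡ d + e → (1ℤ + k) * b ≡ (1ℤ + n) * d →
        (1ℤ + (1ℤ + k)) * c ≡ (1ℤ + n) * e → (1ℤ + (1ℤ + k)) * a ≡ (1ℤ + (1ℤ + n)) * b
  alg n k a b c d e p q r s = by (refl ⊞ 1ℤ + (1ℤ + k) · p ⊞ - (1ℤ + n) · q ⊞ 1ℤ · r ⊞ 1ℤ · s)
    (solve (n ∷ k ∷ a ∷ b ∷ c ∷ d ∷ e ∷ []))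

bin-raise : ∀ n k → (1ℤ + + k) * bin n (suc k) ≡ (+ n - + k) * bin n k
bin-raise n k = alg (+ n) (+ k) (bin (suc n) (suc k)) (bin n k) (bin n (suc k)) (bin-pascal n k) (bin-absorb n k)
  where
  alg : ∀ n k a b c → a ≡ b + c → (1ℤ + k) * a ≡ (1ℤ + n) * b → (1ℤ + k) * c ≡ (n - k) * b
  alg n k a b c p q = by (refl ⊞ - (1ℤ + k) · p ⊞ 1ℤ · q) (solve (n ∷ k ∷ a ∷ b ∷ c ∷ []))

bin-up : ∀ n k → (1ℤ + + n - + k) * bin (suc n) k ≡ (1ℤ + + n) * bin n k
bin-up n k = alg (+ n) (+ k) (bin (suc n) k) (bin (suc n) (suc k)) (bin n k) (bin-raise (suc n) k) (bin-absorb n k)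
  where
  alg : ∀ n k a b c → (1ℤ + k) * b ≡ (1ℤ + n - k) * a → (1ℤ + k) * b ≡ (1ℤ + n) * c →
        (1ℤ + n - k) * a ≡ (1ℤ + n) * c
  alg n k a b c p q = trans (sym p) q

-- At `n = 0` the value `pred 0 = 0` is a mere convention, removed by the factor `+ n`. In the same
-- way the recurrences in `k` below hold from `k = 0` on, because their terms at `pred k` carry a
-- factor `+ k`.
bin-pred : ∀ n k → + n * bin (pred n) k ≡ (+ n - + k) * bin n k
bin-pred (suc n) k       = sym (bin-up n k)
bin-pred zero    zero    = refl
bin-pred zero    (suc k) = sym (trans (cong ((0ℤ - + suc k) *_) (bin-< {0} {suc k} (ℕ.s≤s ℕ.z≤n))) (*-zeroʳ (0ℤ - + suc k)))

-- The functions bᵢ(k) and their ratios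

opaque

  b : ℕ → ℕ → ℤ
  b i k = bin k i * bin (k ℕ.+ i) i

  b-def : ∀ i k → b i k ≡ bin k i * bin (k ℕ.+ i) i
  b-def i k = refl

  b-zero : ∀ k → b 0 k ≡ 1ℤ
  b-zero k = cong₂ _*_ (bin-zero k) (bin-zero (k ℕ.+ 0))

  b-< : ∀ {i k} → k ℕ.< i → b i k ≡ 0ℤ
  b-< {i} {k} k<i = trans (cong (_* bin (k ℕ.+ i) i) (bin-< k<i)) (*-zeroˡ (bin (k ℕ.+ i) i))

  -- The ratios (k - i)/(i+1) and (k + i + 1)/(i+1) of the two factors multiply to a function of
  -- k(k+1). Hence `b i k` depends on `k` only through k(k+1); this symmetry under k ↦ -1-k is what
  -- later admits negative arguments.
  b-raise : ∀ i k → (1ℤ + + i) * (1ℤ + + i) * b (suc i) k ≡ (+ k * (1ℤ + + k) - + i * (1ℤ + + i)) * b i k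
  b-raise i k rewrite ℕ.+-suc k i =
    alg (+ i) (+ k) (bin k (suc i)) (bin k i) (bin (suc (k ℕ.+ i)) (suc i)) (bin (k ℕ.+ i) i)
      (bin-raise k i) (bin-absorb (k ℕ.+ i) i)
    where
    alg : ∀ i k a c d e → (1ℤ + i) * a ≡ (k - i) * c → (1ℤ + i) * d ≡ (1ℤ + (k + i)) * e →
          (1ℤ + i) * (1ℤ + i) * (a * d) ≡ (k * (1ℤ + k) - i * (1ℤ + i)) * (c * e)
    alg i k a c d e p q = by (refl ⊞ (1ℤ + i) * d · p ⊞ (k - i) * c · q) (solve (i ∷ k ∷ a ∷ c ∷ d ∷ e ∷ []))

  b-up : ∀ i k → (1ℤ + + k - + i) * b i (suc k) ≡ (1ℤ + + k + + i) * b i k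
  b-up i k =
    alg (+ i) (+ k) (bin (suc k) i) (bin k i) (bin (suc (k ℕ.+ i)) i) (bin (k ℕ.+ i) i)
      (bin-up k i) (bin-up (k ℕ.+ i) i)
    where
    alg : ∀ i k a c d e → (1ℤ + k - i) * a ≡ (1ℤ + k) * c → (1ℤ + (k + i) - i) * d ≡ (1ℤ + (k + i)) * e →
          (1ℤ + k - i) * (a * d) ≡ (1ℤ + k + i) * (c * e)
    alg i k a c d e p q = by (refl ⊞ d · p ⊞ c · q) (solve (i ∷ k ∷ a ∷ c ∷ d ∷ e ∷ []))

  b-raise-up : ∀ i k → (1ℤ + + i) * (1ℤ + + i) * b (suc i) (suc k) ≡ (+ 2 + + k + + i) * (1ℤ + + k + + i) * b i k
  b-raise-up i k rewrite ℕ.+-suc k i =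
    alg (+ i) (+ k) (bin (suc k) (suc i)) (bin k i) (bin (suc (suc (k ℕ.+ i))) (suc i)) (bin (suc (k ℕ.+ i)) i) (bin (k ℕ.+ i) i)
      (bin-absorb k i) (bin-absorb (suc (k ℕ.+ i)) i) (bin-up (k ℕ.+ i) i)
    where
    alg : ∀ i k a c d e f → (1ℤ + i) * a ≡ (1ℤ + k) * c → (1ℤ + i) * d ≡ (1ℤ + (1ℤ + (k + i))) * e →
          (1ℤ + (k + i) - i) * e ≡ (1ℤ + (k + i)) * f →
          (1ℤ + i) * (1ℤ + i) * (a * d) ≡ (+ 2 + k + i) * (1ℤ + k + i) * (c * f)
    alg i k a c d e f p q r = by (refl ⊞ (1ℤ + i) * d · p ⊞ (1ℤ + k) * c · q ⊞ (+ 2 + k + i) * c · r)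
      (solve (i ∷ k ∷ a ∷ c ∷ d ∷ e ∷ f ∷ []))

-- Settles the boundary `k = 0` of the relations that contain `pred k`, where `pred 0 = 0`.
i*bᵢ0≡0 : ∀ i → + i * b i 0 ≡ 0ℤ
i*bᵢ0≡0 zero    = refl
i*bᵢ0≡0 (suc i) = trans (cong (+ suc i *_) (b-< {suc i} {0} (ℕ.s≤s ℕ.z≤n))) (*-zeroʳ (+ suc i))

b-pred : ∀ i k → (+ k - + i) * b i k ≡ (+ k + + i) * b i (pred k)
b-pred i zero    = alg (+ i) (b i 0) (i*bᵢ0≡0 i)
  where
  alg : ∀ i b → i * b ≡ 0ℤ → (0ℤ - i) * b ≡ (0ℤ + i) * b
  alg i b p = by (refl ⊞ - + 2 · p) (solve (i ∷ b ∷ []))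
b-pred i (suc k) = b-up i k

b-raise-pred : ∀ i k → (1ℤ + + i) * (1ℤ + + i) * b (suc i) (pred k) ≡ (+ k - 1ℤ - + i) * (+ k - + i) * b i k
b-raise-pred i zero    = alg (+ i) (b i 0) (b (suc i) 0) (i*bᵢ0≡0 i) (b-< {suc i} {0} (ℕ.s≤s ℕ.z≤n))
  where
  alg : ∀ i b c → i * b ≡ 0ℤ → c ≡ 0ℤ → (1ℤ + i) * (1ℤ + i) * c ≡ (0ℤ - 1ℤ - i) * (0ℤ - i) * b
  alg i b c p q = by (refl ⊞ - (1ℤ + i) · p ⊞ (1ℤ + i) * (1ℤ + i) · q) (solve (i ∷ b ∷ c ∷ []))
b-raise-pred i (suc k) = alg (+ i) (+ k) (b i k) (b i (suc k)) (b (suc i) k) (b-raise i k) (b-up i k)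
  where
  alg : ∀ i k b b⁺ c → (1ℤ + i) * (1ℤ + i) * c ≡ (k * (1ℤ + k) - i * (1ℤ + i)) * b →
        (1ℤ + k - i) * b⁺ ≡ (1ℤ + k + i) * b →
        (1ℤ + i) * (1ℤ + i) * c ≡ (1ℤ + k - 1ℤ - i) * (1ℤ + k - i) * b⁺
  alg i k b b⁺ c p q = by (refl ⊞ 1ℤ · p ⊞ i - k · q) (solve (i ∷ k ∷ b ∷ b⁺ ∷ c ∷ []))

-- This is `b-up` times k + 1 + i. Together with `b-square-pred` it trades a factor (k+1)² or k² for
-- i², up to a multiple of `b i k`. The i² terms go into certificates, whose shift to i + 1 is
-- brought back to `b i k` by `b-raise-up` and `b-raise-pred`.
b-square-up : ∀ i k → (1ℤ + + k) * (1ℤ + + k) * b i (suc k) ≡ + i * + i * b i (suc k) + (1ℤ + + k + + i) * (1ℤ + + k + + i) * b i k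
b-square-up i k = alg (+ i) (+ k) (b i k) (b i (suc k)) (b-up i k)
  where
  alg : ∀ i k b b⁺ → (1ℤ + k - i) * b⁺ ≡ (1ℤ + k + i) * b →
        (1ℤ + k) * (1ℤ + k) * b⁺ ≡ i * i * b⁺ + (1ℤ + k + i) * (1ℤ + k + i) * b
  alg i k b b⁺ p = by (refl ⊞ 1ℤ + k + i · p) (solve (i ∷ k ∷ b ∷ b⁺ ∷ []))

b-square-pred : ∀ i k → + k * + k * b i (pred k) ≡ + i * + i * b i (pred k) + (+ k - + i) * (+ k - + i) * b i k
b-square-pred i k = alg (+ i) (+ k) (b i k) (b i (pred k)) (b-pred i k)
  where
  alg : ∀ i k b b⁻ → (k - i) * b ≡ (k + i) * b⁻ → k * k * b⁻ ≡ i * i * b⁻ + (k - i) * (k - i) * b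
  alg i k b b⁻ p = by (refl ⊞ i - k · p) (solve (i ∷ k ∷ b ∷ b⁻ ∷ []))

-- Central binomial coefficients

opaque

  c : ℕ → ℤ
  c i = bin (i ℕ.+ i) i

  -- Half of `c (suc i)`, that is (2i+1)/(i+1) times `c i`, kept as a binomial coefficient to remain
  -- integral.
  e : ℕ → ℤ
  e i = bin (suc (i ℕ.+ i)) (suc i)

  e-c : ∀ i → (1ℤ + + i) * e i ≡ (+ 2 * + i + 1ℤ) * c i
  e-c i = trans (bin-absorb (i ℕ.+ i) i) (cong (_* c i) (alg (+ i)))
    where
    alg : ∀ i → 1ℤ + (i + i) ≡ + 2 * i + 1ℤ
    alg = solve-∀

  c-suc : ∀ i → c (suc i) ≡ + 2 * e i
  c-suc i rewrite ℕ.+-suc i i = trans (bin-pascal (suc (i ℕ.+ i)) i) (trans (cong (_+ e i) eq) (alg (e i)))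
    where
    alg : ∀ x → x + x ≡ + 2 * x
    alg = solve-∀
    algᵉ : ∀ i x y → (1ℤ + i) * y ≡ (1ℤ + (i + i) - i) * x → (1ℤ + i) * x ≡ (1ℤ + i) * y
    algᵉ i x y p = by (refl ⊞ - 1ℤ · p) (solve (i ∷ x ∷ y ∷ []))
    eq : bin (suc (i ℕ.+ i)) i ≡ e i
    eq = cancel i (algᵉ (+ i) _ _ (bin-raise (suc (i ℕ.+ i)) i))

  c-zero : c 0 ≡ 1ℤ
  c-zero = bin-zero 0

  catalan : ∀ i → ∃ λ z → c i ≡ (1ℤ + + i) * z
  -- The witness is the Catalan number, as C(2i,i) - C(2i,i+1).
  catalan i = c i - bin (i ℕ.+ i) (suc i) , alg (+ i) (c i) (bin (i ℕ.+ i) (suc i)) (bin-raise (i ℕ.+ i) i)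
    where
    alg : ∀ i x y → (1ℤ + i) * y ≡ (i + i - i) * x → x ≡ (1ℤ + i) * (x - y)
    alg i x y p = by (refl ⊞ 1ℤ · p) (solve (i ∷ x ∷ y ∷ []))

c-raise : ∀ i → (1ℤ + + i) * c (suc i) ≡ + 2 * (+ 2 * + i + 1ℤ) * c i
c-raise i = alg (+ i) (c i) (c (suc i)) (e i) (c-suc i) (e-c i)
  where
  alg : ∀ i c c⁺ e → c⁺ ≡ + 2 * e → (1ℤ + i) * e ≡ (+ 2 * i + 1ℤ) * c → (1ℤ + i) * c⁺ ≡ + 2 * (+ 2 * i + 1ℤ) * c
  alg i c c⁺ e p q = by (refl ⊞ 1ℤ + i · p ⊞ + 2 · q) (solve (i ∷ c ∷ c⁺ ∷ e ∷ []))

-- Squares of s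

module S-square (n : ℕ) where

  X : ℤ
  X = + n * (1ℤ + + n)

  -- The range is a fixed `N` instead of `suc k`, so that neighbouring values of `k` share it; for
  -- `k < N` the added terms vanish with `bin k i`.
  sₙ : ℕ → ℕ → ℤ
  sₙ N k = ∑ N (λ i → bin k i * b i n)

  sₙ-recurrence : ∀ N k → suc k ℕ.< N →
    (1ℤ + + k) * (1ℤ + + k) * sₙ N (suc k) + + k * + k * sₙ N (pred k)
      ≡ (+ 2 * (+ k * (1ℤ + + k)) + 1ℤ + X) * sₙ N k
  sₙ-recurrence N k k<N = begin
    (1ℤ + + k) * (1ℤ + + k) * sₙ N (suc k) + + k * + k * sₙ N (pred k)
      ≡⟨ cong₂ _+_ (∑-*ˡ N ((1ℤ + + k) * (1ℤ + + k)) _) (∑-*ˡ N (+ k * + k) _) ⟩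
    ∑ N (λ i → (1ℤ + + k) * (1ℤ + + k) * (bin (suc k) i * b i n)) + ∑ N (λ i → + k * + k * (bin (pred k) i * b i n))
      ≡⟨ ∑-+ N _ _ ⟩
    ∑ N (λ i → (1ℤ + + k) * (1ℤ + + k) * (bin (suc k) i * b i n) + + k * + k * (bin (pred k) i * b i n))
      ≡⟨ sym (∑-telescope N _ _ V step refl Vₙ) ⟩
    ∑ N (λ i → (+ 2 * (+ k * (1ℤ + + k)) + 1ℤ + X) * (bin k i * b i n))
      ≡⟨ sym (∑-*ˡ N (+ 2 * (+ k * (1ℤ + + k)) + 1ℤ + X) _) ⟩
    (+ 2 * (+ k * (1ℤ + + k)) + 1ℤ + X) * sₙ N k ∎
    where
    open ≡-Reasoning
    -- The bound `suc k < N` makes the certificate vanish at `N`, where it contains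
    -- `bin k (pred N)`.
    V : ℕ → ℤ
    V i = + i * + i * (bin k (pred i) * b i n)
    Vₙ : V N ≡ 0ℤ
    Vₙ = trans (cong (λ z → + N * + N * (z * b N n)) (bin-< (ℕ.<⇒≤pred k<N))) (*-zeroʳ (+ N * + N))
    alg₀ : ∀ k X P B B⁺ P⁺ P⁻ → (1ℤ + 0ℤ) * (1ℤ + 0ℤ) * B⁺ ≡ (X - 0ℤ * (1ℤ + 0ℤ)) * B →
      P⁺ ≡ 1ℤ → P ≡ 1ℤ → P⁻ ≡ 1ℤ →
      (+ 2 * (k * (1ℤ + k)) + 1ℤ + X) * (P * B) + 0ℤ
        ≡ (1ℤ + k) * (1ℤ + k) * (P⁺ * B) + k * k * (P⁻ * B) + (1ℤ + 0ℤ) * (1ℤ + 0ℤ) * (P * B⁺)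
    alg₀ k X P B B⁺ P⁺ P⁻ h refl refl refl = by (refl ⊞ - 1ℤ · h) (solve (k ∷ X ∷ B ∷ B⁺ ∷ []))
    alg : ∀ k X j P Q R M B B⁺ →
      (1ℤ + (1ℤ + j)) * (1ℤ + (1ℤ + j)) * B⁺ ≡ (X - (1ℤ + j) * (1ℤ + (1ℤ + j))) * B →
      R ≡ P + Q → (1ℤ + j) * Q ≡ (k - j) * P → k * M ≡ (k - (1ℤ + j)) * Q →
      (+ 2 * (k * (1ℤ + k)) + 1ℤ + X) * (Q * B) + (1ℤ + j) * (1ℤ + j) * (P * B)
        ≡ (1ℤ + k) * (1ℤ + k) * (R * B) + k * k * (M * B) + (1ℤ + (1ℤ + j)) * (1ℤ + (1ℤ + j)) * (Q * B⁺)
    alg k X j P Q R M B B⁺ h p q r =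
      by (refl ⊞ - Q · h ⊞ - (1ℤ + k) * (1ℤ + k) * B · p ⊞ (k + j + + 2) * B · q ⊞ - k * B · r)
         (solve (k ∷ X ∷ j ∷ P ∷ Q ∷ R ∷ M ∷ B ∷ B⁺ ∷ []))
    step : ∀ i → (+ 2 * (+ k * (1ℤ + + k)) + 1ℤ + X) * (bin k i * b i n) + V i
      ≡ (1ℤ + + k) * (1ℤ + + k) * (bin (suc k) i * b i n) + + k * + k * (bin (pred k) i * b i n) + V (suc i)
    step zero    = alg₀ (+ k) X (bin k 0) (b 0 n) (b 1 n) (bin (suc k) 0) (bin (pred k) 0)
      (b-raise 0 n) (bin-zero _) (bin-zero _) (bin-zero _)
    step (suc j) = alg (+ k) X (+ j) (bin k j) (bin k (suc j)) (bin (suc k) (suc j)) (bin (pred k) (suc j))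
      (b (suc j) n) (b (suc (suc j)) n) (b-raise (suc j) n) (bin-pascal k j) (bin-raise k j) (bin-pred k (suc j))

  -- W i j is the image of zʲ (z + z²)ⁱ under the linear map zˡ ↦ b l n.
  W : ℕ → ℕ → ℤ
  W zero    j = b j n
  W (suc i) j = W i (suc j) + W i (suc (suc j))

  -- By `b-raise`, X bₗ = l(l+1) bₗ + (l+1)² bₗ₊₁, so multiplication by `X` acts on polynomials in z
  -- as ϑ(ϑ+1) + z(ϑ+1)² with ϑ = z d/dz. The formula is the effect of this operator on zʲ (z +
  -- z²)ⁱ, obtained by induction on `i`.
  W-X : ∀ i j → X * W i j ≡ (+ j * (1ℤ + + j) + + i * (+ 2 * + j + 1ℤ)) * W i j
    + + i * + i * W (pred i) (suc j) + (1ℤ + + j + + 2 * + i) * (1ℤ + + j + + 2 * + i) * W i (suc j)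
  W-X zero j = alg X (+ j) (b j n) (b (suc j) n) (b-raise j n)
    where
    alg : ∀ X j B B⁺ → (1ℤ + j) * (1ℤ + j) * B⁺ ≡ (X - j * (1ℤ + j)) * B →
      X * B ≡ (j * (1ℤ + j) + 0ℤ * (+ 2 * j + 1ℤ)) * B + 0ℤ * 0ℤ * B⁺ + (1ℤ + j + + 2 * 0ℤ) * (1ℤ + j + + 2 * 0ℤ) * B⁺
    alg X j B B⁺ h = by (refl ⊞ - 1ℤ · h) (solve (X ∷ j ∷ B ∷ B⁺ ∷ []))
  W-X (suc i) j = alg X (+ i) (+ j) (W i (1 ℕ.+ j)) (W i (2 ℕ.+ j)) (W i (3 ℕ.+ j))
      (W (pred i) (2 ℕ.+ j)) (W (pred i) (3 ℕ.+ j)) (W-X i (suc j)) (W-X i (suc (suc j))) (split i)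
    where
    -- The factor i² discards `i = 0`, where `pred i` is not a predecessor.
    split : ∀ i → + i * + i * W i (1 ℕ.+ j) ≡ + i * + i * (W (pred i) (2 ℕ.+ j) + W (pred i) (3 ℕ.+ j))
    split zero    = refl
    split (suc i) = refl
    alg : ∀ X i j W₁ W₂ W₃ U₂ U₃ →
      X * W₁ ≡ ((1ℤ + j) * (1ℤ + (1ℤ + j)) + i * (+ 2 * (1ℤ + j) + 1ℤ)) * W₁
        + i * i * U₂ + (1ℤ + (1ℤ + j) + + 2 * i) * (1ℤ + (1ℤ + j) + + 2 * i) * W₂ →
      X * W₂ ≡ ((+ 2 + j) * (1ℤ + (+ 2 + j)) + i * (+ 2 * (+ 2 + j) + 1ℤ)) * W₂
        + i * i * U₃ + (1ℤ + (+ 2 + j) + + 2 * i) * (1ℤ + (+ 2 + j) + + 2 * i) * W₃ →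
      i * i * W₁ ≡ i * i * (U₂ + U₃) →
      X * (W₁ + W₂) ≡ (j * (1ℤ + j) + (1ℤ + i) * (+ 2 * j + 1ℤ)) * (W₁ + W₂)
        + (1ℤ + i) * (1ℤ + i) * W₁ + (1ℤ + j + + 2 * (1ℤ + i)) * (1ℤ + j + + 2 * (1ℤ + i)) * (W₂ + W₃)
    alg X i j W₁ W₂ W₃ U₂ U₃ h₁ h₂ s = by (refl ⊞ 1ℤ · h₁ ⊞ 1ℤ · h₂ ⊞ - 1ℤ · s)
      (solve (X ∷ i ∷ j ∷ W₁ ∷ W₂ ∷ W₃ ∷ U₂ ∷ U₃ ∷ []))

  η θ : ℕ → ℤ
  η i = W i 0
  θ i = W i 1

  η-X : ∀ i → X * η i ≡ + i * η i + + i * + i * θ (pred i) + (+ 2 * + i + 1ℤ) * (+ 2 * + i + 1ℤ) * θ i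
  η-X i = alg X (+ i) (η i) (θ i) (θ (pred i)) (W-X i 0)
    where
    alg : ∀ X i η θ θ⁻ → X * η ≡ (0ℤ * (1ℤ + 0ℤ) + i * (+ 2 * 0ℤ + 1ℤ)) * η
        + i * i * θ⁻ + (1ℤ + 0ℤ + + 2 * i) * (1ℤ + 0ℤ + + 2 * i) * θ →
      X * η ≡ i * η + i * i * θ⁻ + (+ 2 * i + 1ℤ) * (+ 2 * i + 1ℤ) * θ
    alg X i η θ θ⁻ h = by (refl ⊞ 1ℤ · h) (solve (X ∷ i ∷ η ∷ θ ∷ θ⁻ ∷ []))

  -- The terms `W i 2` and `W (pred i) 2` from `W-X` are eliminated through η(i+1) = θ(i) + `W i 2`
  -- and its analogue one step lower. Thus `η` and `θ` form a closed system under multiplication by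
  -- `X`.
  θ-X : ∀ i → X * θ i ≡ + 4 * ((1ℤ + + i) * (1ℤ + + i)) * η (suc i) + + i * + i * η i
    - (+ 4 * (+ i * + i) + + 5 * + i + + 2) * θ i - + i * + i * θ (pred i)
  θ-X i = alg X (+ i) (η i) (θ i) (θ (pred i)) (W i 2) (W (pred i) 2) (W-X i 1) (split i)
    where
    split : ∀ i → + i * + i * η i ≡ + i * + i * (θ (pred i) + W (pred i) 2)
    split zero    = refl
    split (suc i) = refl
    alg : ∀ X i η θ θ⁻ Y Y⁻ → X * θ ≡ (1ℤ * (1ℤ + 1ℤ) + i * (+ 2 * 1ℤ + 1ℤ)) * θ
        + i * i * Y⁻ + (1ℤ + 1ℤ + + 2 * i) * (1ℤ + 1ℤ + + 2 * i) * Y →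
      i * i * η ≡ i * i * (θ⁻ + Y⁻) →
      X * θ ≡ + 4 * ((1ℤ + i) * (1ℤ + i)) * (θ + Y) + i * i * η
        - (+ 4 * (i * i) + + 5 * i + + 2) * θ - i * i * θ⁻
    alg X i η θ θ⁻ Y Y⁻ h s = by (refl ⊞ 1ℤ · h ⊞ - 1ℤ · s) (solve (X ∷ i ∷ η ∷ θ ∷ θ⁻ ∷ Y ∷ Y⁻ ∷ []))

  -- Closed forms for the square and for the product of neighbours

  D : ℕ → ℕ → ℤ
  D N k = ∑ N (λ i → b i k * c i * η i)

  F : ℕ → ℕ → ℤ
  F N k = ∑ N (λ i → + k * (+ k - + i) * (b i k * (c i * η i + e i * θ i)))

  F-suc : ∀ N k → F N (suc k) ≡ ∑ N (λ i → (1ℤ + + k) * (1ℤ + + k + + i) * (b i k * (c i * η i + e i * θ i)))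
  F-suc N k = ∑-cong N λ i → alg (+ k) (+ i) (b i k) (b i (suc k)) (c i * η i + e i * θ i) (b-up i k)
    where
    alg : ∀ k i b b⁺ q → (1ℤ + k - i) * b⁺ ≡ (1ℤ + k + i) * b →
      (1ℤ + k) * (1ℤ + k - i) * (b⁺ * q) ≡ (1ℤ + k) * (1ℤ + k + i) * (b * q)
    alg k i b b⁺ q h = by (refl ⊞ (1ℤ + k) * q · h) (solve (k ∷ i ∷ b ∷ b⁺ ∷ q ∷ []))

  -- With `D` read as s_k² and `F` as k² s_k s_{k-1}, this is `sₙ-recurrence` multiplied by s_k. It
  -- is established here for the closed forms themselves.
  F-sum : ∀ N k → k ℕ.< N → F N (suc k) + F N k ≡ (+ 2 * (+ k * (1ℤ + + k)) + 1ℤ + X) * D N k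
  F-sum N k k<N = begin
    F N (suc k) + F N k
      ≡⟨ trans (cong (_+ F N k) (F-suc N k)) (∑-+ N _ _) ⟩
    ∑ N (λ i → (1ℤ + + k) * (1ℤ + + k + + i) * (b i k * (c i * η i + e i * θ i))
             + + k * (+ k - + i) * (b i k * (c i * η i + e i * θ i)))
      ≡⟨ ∑-telescope N _ _ V step (cong (_* θ 0) (*-zeroʳ (c 0 * b 0 k))) Vₙ ⟩
    ∑ N (λ i → (+ 2 * (+ k * (1ℤ + + k)) + 1ℤ + X) * (b i k * c i * η i))
      ≡⟨ sym (∑-*ˡ N (+ 2 * (+ k * (1ℤ + + k)) + 1ℤ + X) _) ⟩
    (+ 2 * (+ k * (1ℤ + + k)) + 1ℤ + X) * D N k ∎
    where
    open ≡-Reasoning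
    -- Chosen to cancel the i² θ(i-1) term of `η-X`.
    V : ℕ → ℤ
    V i = c i * b i k * (+ i * + i) * θ (pred i)
    Vₙ : V N ≡ 0ℤ
    Vₙ = trans (cong (λ z → c N * z * (+ N * + N) * θ (pred N)) (b-< k<N)) (alg₀ (c N) (+ N) (θ (pred N)))
      where
      alg₀ : ∀ c n θ → c * 0ℤ * (n * n) * θ ≡ 0ℤ
      alg₀ = solve-∀
    alg : ∀ k X i b b⁺ c c⁺ e η θ θ⁻ →
      (1ℤ + i) * (1ℤ + i) * b⁺ ≡ (k * (1ℤ + k) - i * (1ℤ + i)) * b →
      c⁺ ≡ + 2 * e → (1ℤ + i) * e ≡ (+ 2 * i + 1ℤ) * c →
      X * η ≡ i * η + i * i * θ⁻ + (+ 2 * i + 1ℤ) * (+ 2 * i + 1ℤ) * θ →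
      (1ℤ + k) * (1ℤ + k + i) * (b * (c * η + e * θ)) + k * (k - i) * (b * (c * η + e * θ)) + c * b * (i * i) * θ⁻
       ≡ (+ 2 * (k * (1ℤ + k)) + 1ℤ + X) * (b * c * η) + c⁺ * b⁺ * ((1ℤ + i) * (1ℤ + i)) * θ
    alg k X i b b⁺ c c⁺ e η θ θ⁻ hb hc he hX =
      by (refl ⊞ 0ℤ - + 2 * e * θ · hb ⊞ 0ℤ - b⁺ * ((1ℤ + i) * (1ℤ + i)) * θ · hc
               ⊞ b * θ * (+ 2 * i + 1ℤ) · he ⊞ 0ℤ - b * c · hX)
         (solve (k ∷ X ∷ i ∷ b ∷ b⁺ ∷ c ∷ c⁺ ∷ e ∷ η ∷ θ ∷ θ⁻ ∷ []))
    step : ∀ i → (1ℤ + + k) * (1ℤ + + k + + i) * (b i k * (c i * η i + e i * θ i))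
             + + k * (+ k - + i) * (b i k * (c i * η i + e i * θ i)) + V i
      ≡ (+ 2 * (+ k * (1ℤ + + k)) + 1ℤ + X) * (b i k * c i * η i) + V (suc i)
    step i = alg (+ k) X (+ i) (b i k) (b (suc i) k) (c i) (c (suc i)) (e i) (η i) (θ i) (θ (pred i))
      (b-raise i k) (c-suc i) (e-c i) (η-X i)

  G : ℕ → ℕ → ℤ
  G N k = ∑ N (λ i → b i k * c i * ((1ℤ + + i) * η i + (+ 2 * + i + 1ℤ) * θ i))

  F-difference : ∀ N k → F N (suc k) ≡ F N k + (+ 2 * + k + 1ℤ) * G N k
  F-difference N k = trans (F-suc N k) (trans (∑-cong N step) (sym (trans
      (cong (λ z → F N k + z) (∑-*ˡ N (+ 2 * + k + 1ℤ) _)) (∑-+ N _ _))))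
    where
    alg : ∀ k i b c e η θ → (1ℤ + i) * e ≡ (+ 2 * i + 1ℤ) * c →
      (1ℤ + k) * (1ℤ + k + i) * (b * (c * η + e * θ)) ≡
      k * (k - i) * (b * (c * η + e * θ)) + (+ 2 * k + 1ℤ) * (b * c * ((1ℤ + i) * η + (+ 2 * i + 1ℤ) * θ))
    alg k i b c e η θ h = by (refl ⊞ (+ 2 * k + 1ℤ) * b * θ · h) (solve (k ∷ i ∷ b ∷ c ∷ e ∷ η ∷ θ ∷ []))
    step : ∀ i → (1ℤ + + k) * (1ℤ + + k + + i) * (b i k * (c i * η i + e i * θ i)) ≡
      + k * (+ k - + i) * (b i k * (c i * η i + e i * θ i))
      + (+ 2 * + k + 1ℤ) * (b i k * c i * ((1ℤ + + i) * η i + (+ 2 * + i + 1ℤ) * θ i))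
    step i = alg (+ k) (+ i) (b i k) (c i) (e i) (η i) (θ i) (e-c i)

  -- Modelled on a difference of squares. In ((k+1)² s_{k+1})² - (k² s_{k-1})² the sum of the two
  -- bases is m s_k with m = 2k(k+1) + 1 + X, and s_k times their difference is F_{k+1} - F_k =
  -- (2k+1) G_k.
  D-recurrence : ∀ N k → suc k ℕ.< N →
    (1ℤ + + k) * (1ℤ + + k) * ((1ℤ + + k) * (1ℤ + + k)) * D N (suc k) ≡
    (+ 2 * (+ k * (1ℤ + + k)) + 1ℤ + X) * (+ 2 * + k + 1ℤ) * G N k + + k * + k * (+ k * + k) * D N (pred k)
  D-recurrence N k k<N = begin
    (1ℤ + + k) * (1ℤ + + k) * ((1ℤ + + k) * (1ℤ + + k)) * D N (suc k)
      ≡⟨ ∑-*ˡ N ((1ℤ + + k) * (1ℤ + + k) * ((1ℤ + + k) * (1ℤ + + k))) _ ⟩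
    ∑ N (λ i → (1ℤ + + k) * (1ℤ + + k) * ((1ℤ + + k) * (1ℤ + + k)) * (b i (suc k) * c i * η i))
      ≡⟨ sym (∑-telescope N _ _ V step (algV₀ (b 0 k) (b 0 (suc k)) (b 0 (pred k)) (c 0) (+ k) (η 0) (θ 0)) Vₙ) ⟩
    ∑ N (λ i → (+ 2 * (+ k * (1ℤ + + k)) + 1ℤ + X) * (+ 2 * + k + 1ℤ) * (b i k * c i * ((1ℤ + + i) * η i + (+ 2 * + i + 1ℤ) * θ i))
             + + k * + k * (+ k * + k) * (b i (pred k) * c i * η i))
      ≡⟨ sym (trans (cong₂ _+_ (∑-*ˡ N ((+ 2 * (+ k * (1ℤ + + k)) + 1ℤ + X) * (+ 2 * + k + 1ℤ)) _)
                               (∑-*ˡ N (+ k * + k * (+ k * + k)) _)) (∑-+ N _ _)) ⟩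
    (+ 2 * (+ k * (1ℤ + + k)) + 1ℤ + X) * (+ 2 * + k + 1ℤ) * G N k + + k * + k * (+ k * + k) * D N (pred k) ∎
    where
    open ≡-Reasoning
    -- The second summand collects the i² terms left by `b-square-up` and `b-square-pred`; the first
    -- one settles what remains after division by 2k + 1.
    V : ℕ → ℤ
    V i = (+ 2 * + k + 1ℤ) * (b i k * c i * (+ i * + i * + i) * θ (pred i) - (+ 2 * + i + 1ℤ) * b i k * c i * (+ i * + i) * η i)
        + c i * η i * ((1ℤ + + k) * (1ℤ + + k) * (+ i * + i * b i (suc k)) - + k * + k * (+ i * + i * b i (pred k)))
    algV₀ : ∀ b b⁺ b⁻ c k η θ → (+ 2 * k + 1ℤ) * (b * c * (0ℤ * 0ℤ * 0ℤ) * θ - (+ 2 * 0ℤ + 1ℤ) * b * c * (0ℤ * 0ℤ) * η)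
        + c * η * ((1ℤ + k) * (1ℤ + k) * (0ℤ * 0ℤ * b⁺) - k * k * (0ℤ * 0ℤ * b⁻)) ≡ 0ℤ
    algV₀ = solve-∀
    algVₙ : ∀ b b⁺ b⁻ c k i η θ → b ≡ 0ℤ → b⁺ ≡ 0ℤ → b⁻ ≡ 0ℤ →
        (+ 2 * k + 1ℤ) * (b * c * (i * i * i) * θ - (+ 2 * i + 1ℤ) * b * c * (i * i) * η)
        + c * η * ((1ℤ + k) * (1ℤ + k) * (i * i * b⁺) - k * k * (i * i * b⁻)) ≡ 0ℤ
    algVₙ b b⁺ b⁻ c k i η θ refl refl refl = solve (c ∷ k ∷ i ∷ η ∷ θ ∷ [])
    Vₙ : V N ≡ 0ℤ
    Vₙ = algVₙ (b N k) (b N (suc k)) (b N (pred k)) (c N) (+ k) (+ N) (η N) (θ (pred N))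
      (b-< (ℕ.<⇒≤ k<N)) (b-< k<N) (b-< (ℕ.<-≤-trans (ℕ.s≤s (ℕ.pred[n]≤n {k})) (ℕ.<⇒≤ k<N)))

    -- Quotients by 2k + 1: `R` of the part of the i-th term of (k+1)⁴ D_{k+1} - k⁴ D_{k-1} outside
    -- the certificate, `Q` of the second summand of the certificate at i + 1.
    R Q : ℕ → ℤ
    R i = b i k * c i * (1ℤ + + i) * (+ 2 * (+ k * (1ℤ + + k)) + 1ℤ + + i) * η i
    Q i = c (suc i) * η (suc i) * b i k * ((+ 2 * + i + + 3) * (+ k * (1ℤ + + k)) + (1ℤ + + i) * (+ 2 + + i))

    alg₁ : ∀ k i b b⁺ b⁻ c η →
      (1ℤ + k) * (1ℤ + k) * b⁺ ≡ i * i * b⁺ + (1ℤ + k + i) * (1ℤ + k + i) * b →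
      k * k * b⁻ ≡ i * i * b⁻ + (k - i) * (k - i) * b →
      (1ℤ + k) * (1ℤ + k) * ((1ℤ + k) * (1ℤ + k)) * (b⁺ * c * η) ≡
      k * k * (k * k) * (b⁻ * c * η)
        + c * η * ((1ℤ + k) * (1ℤ + k) * (i * i * b⁺) - k * k * (i * i * b⁻))
        + (+ 2 * k + 1ℤ) * (b * c * (1ℤ + i) * (+ 2 * (k * (1ℤ + k)) + 1ℤ + i) * η)
    alg₁ k i b b⁺ b⁻ c η p q = by (refl ⊞ (1ℤ + k) * (1ℤ + k) * (c * η) · p ⊞ 0ℤ - k * k * (c * η) · q)
      (solve (k ∷ i ∷ b ∷ b⁺ ∷ b⁻ ∷ c ∷ η ∷ []))

    alg₂ : ∀ k i b b⁺ b⁻ c η →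
      (1ℤ + i) * (1ℤ + i) * b⁺ ≡ (+ 2 + k + i) * (1ℤ + k + i) * b →
      (1ℤ + i) * (1ℤ + i) * b⁻ ≡ (k - 1ℤ - i) * (k - i) * b →
      c * η * ((1ℤ + k) * (1ℤ + k) * ((1ℤ + i) * (1ℤ + i) * b⁺) - k * k * ((1ℤ + i) * (1ℤ + i) * b⁻))
        ≡ (+ 2 * k + 1ℤ) * (c * η * b * ((+ 2 * i + + 3) * (k * (1ℤ + k)) + (1ℤ + i) * (+ 2 + i)))
    alg₂ k i b b⁺ b⁻ c η p q = by (refl ⊞ (1ℤ + k) * (1ℤ + k) * (c * η) · p ⊞ 0ℤ - k * k * (c * η) · q)
      (solve (k ∷ i ∷ b ∷ b⁺ ∷ b⁻ ∷ c ∷ η ∷ []))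

    -- With 2k + 1 removed, `k` occurs only through τ = k(k+1).
    alg₃ : ∀ τ X i b b⁺ c c⁺ η η⁺ θ θ⁻ →
      (1ℤ + i) * (1ℤ + i) * b⁺ ≡ (τ - i * (1ℤ + i)) * b →
      (1ℤ + i) * c⁺ ≡ + 2 * (+ 2 * i + 1ℤ) * c →
      X * η ≡ i * η + i * i * θ⁻ + (+ 2 * i + 1ℤ) * (+ 2 * i + 1ℤ) * θ →
      X * θ ≡ + 4 * ((1ℤ + i) * (1ℤ + i)) * η⁺ + i * i * η - (+ 4 * (i * i) + + 5 * i + + 2) * θ - i * i * θ⁻ →
      (+ 2 * τ + 1ℤ + X) * (b * c * ((1ℤ + i) * η + (+ 2 * i + 1ℤ) * θ))
        + (b * c * (i * i * i) * θ⁻ - (+ 2 * i + 1ℤ) * b * c * (i * i) * η)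
       ≡ b * c * (1ℤ + i) * (+ 2 * τ + 1ℤ + i) * η + c⁺ * η⁺ * b * ((+ 2 * i + + 3) * τ + (1ℤ + i) * (+ 2 + i))
        + (b⁺ * c⁺ * ((1ℤ + i) * (1ℤ + i) * (1ℤ + i)) * θ - (+ 2 * (1ℤ + i) + 1ℤ) * b⁺ * c⁺ * ((1ℤ + i) * (1ℤ + i)) * η⁺)
    alg₃ τ X i b b⁺ c c⁺ η η⁺ θ θ⁻ hb hc hη hθ =
      by (refl ⊞ c⁺ * (+ 2 * (1ℤ + i) + 1ℤ) * η⁺ - (1ℤ + i) * c⁺ * θ · hb
               ⊞ 0ℤ - (τ - i * (1ℤ + i)) * b * θ - + 2 * ((1ℤ + i) * (1ℤ + i)) * b * η⁺ · hc
               ⊞ b * c * (1ℤ + i) · hη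
               ⊞ b * c * (+ 2 * i + 1ℤ) · hθ)
         (solve (τ ∷ X ∷ i ∷ b ∷ b⁺ ∷ c ∷ c⁺ ∷ η ∷ η⁺ ∷ θ ∷ θ⁻ ∷ []))

    alg₄ : ∀ m K g w w⁺ R Q A B Z Z⁺ → A ≡ B + Z + K * R → Z⁺ ≡ K * Q → m * g + w ≡ R + Q + w⁺ →
      m * K * g + B + (K * w + Z) ≡ A + (K * w⁺ + Z⁺)
    alg₄ m K g w w⁺ R Q A B Z Z⁺ p q r = by (refl ⊞ - 1ℤ · p ⊞ - 1ℤ · q ⊞ K · r)
      (solve (m ∷ K ∷ g ∷ w ∷ w⁺ ∷ R ∷ Q ∷ A ∷ B ∷ Z ∷ Z⁺ ∷ []))

    step : ∀ i →
      (+ 2 * (+ k * (1ℤ + + k)) + 1ℤ + X) * (+ 2 * + k + 1ℤ) * (b i k * c i * ((1ℤ + + i) * η i + (+ 2 * + i + 1ℤ) * θ i))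
        + + k * + k * (+ k * + k) * (b i (pred k) * c i * η i) + V i
      ≡ (1ℤ + + k) * (1ℤ + + k) * ((1ℤ + + k) * (1ℤ + + k)) * (b i (suc k) * c i * η i) + V (suc i)
    step i = alg₄ (+ 2 * (+ k * (1ℤ + + k)) + 1ℤ + X) (+ 2 * + k + 1ℤ)
      (b i k * c i * ((1ℤ + + i) * η i + (+ 2 * + i + 1ℤ) * θ i))
      (b i k * c i * (+ i * + i * + i) * θ (pred i) - (+ 2 * + i + 1ℤ) * b i k * c i * (+ i * + i) * η i)
      (b (suc i) k * c (suc i) * ((1ℤ + + i) * (1ℤ + + i) * (1ℤ + + i)) * θ i
        - (+ 2 * (1ℤ + + i) + 1ℤ) * b (suc i) k * c (suc i) * ((1ℤ + + i) * (1ℤ + + i)) * η (suc i))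
      (R i) (Q i)
      ((1ℤ + + k) * (1ℤ + + k) * ((1ℤ + + k) * (1ℤ + + k)) * (b i (suc k) * c i * η i))
      (+ k * + k * (+ k * + k) * (b i (pred k) * c i * η i))
      (c i * η i * ((1ℤ + + k) * (1ℤ + + k) * (+ i * + i * b i (suc k)) - + k * + k * (+ i * + i * b i (pred k))))
      (c (suc i) * η (suc i) * ((1ℤ + + k) * (1ℤ + + k) * ((1ℤ + + i) * (1ℤ + + i) * b (suc i) (suc k))
        - + k * + k * ((1ℤ + + i) * (1ℤ + + i) * b (suc i) (pred k))))
      (alg₁ (+ k) (+ i) (b i k) (b i (suc k)) (b i (pred k)) (c i) (η i) (b-square-up i k) (b-square-pred i k))
      (alg₂ (+ k) (+ i) (b i k) (b (suc i) (suc k)) (b (suc i) (pred k)) (c (suc i)) (η (suc i)) (b-raise-up i k) (b-raise-pred i k))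
      (alg₃ (+ k * (1ℤ + + k)) X (+ i) (b i k) (b (suc i) k) (c i) (c (suc i)) (η i) (η (suc i)) (θ i) (θ (pred i))
        (b-raise i k) (c-raise i) (η-X i) (θ-X i))

  -- As the recurrence has order two, the induction carries all three quadratic expressions in s_k
  -- and s_{k-1}. At `k = 0` the two squares coincide and the factor k² annihilates the product.
  record Squares (N k : ℕ) : Set where
    field
      square      : sₙ N k * sₙ N k ≡ D N k
      square-pred : sₙ N (pred k) * sₙ N (pred k) ≡ D N (pred k)
      cross       : + k * + k * (sₙ N k * sₙ N (pred k)) ≡ F N k

  squares : ∀ N k → k ℕ.< N → Squares N k
  squares (suc N) zero _ = record
    { square = base ; square-pred = base
    ; cross = sym (∑-zero (suc N) λ i → refl) }
    where
    b0 : ∀ i → b (suc i) 0 ≡ 0ℤ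
    b0 i = b-< {suc i} {0} (ℕ.s≤s ℕ.z≤n)
    s₀ : sₙ (suc N) 0 ≡ 1ℤ
    s₀ = trans (∑-head N _ λ i → cong (_* b (suc i) n) (bin-< {0} {suc i} (ℕ.s≤s ℕ.z≤n)))
      (cong₂ _*_ (bin-zero 0) (b-zero n))
    D₀ : D (suc N) 0 ≡ 1ℤ
    D₀ = trans (∑-head N _ λ i → cong (λ z → z * c (suc i) * η (suc i)) (b0 i))
      (cong₂ _*_ (cong₂ _*_ (b-zero 0) c-zero) (b-zero n))
    base : sₙ (suc N) 0 * sₙ (suc N) 0 ≡ D (suc N) 0
    base = trans (cong₂ _*_ s₀ s₀) (sym D₀)
  squares N (suc k) k<N = record
    -- The squares are compared after multiplication by (k+1)⁴.
    { square = cancel² k (cancel² k (alg (+ k) m (sₙ N (suc k)) (sₙ N k) (sₙ N (pred k)) (D N (suc k)) (D N k) (D N (pred k))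
        (F N (suc k)) (F N k) (G N k) (sₙ-recurrence N k k<N) square square-pred cross
        (F-sum N k (ℕ.<⇒≤ k<N)) (F-difference N k) (D-recurrence N k k<N)))
    ; square-pred = square
    ; cross = algᶠ (+ k) m (sₙ N (suc k)) (sₙ N k) (sₙ N (pred k)) (D N k)
        (F N (suc k)) (F N k) (sₙ-recurrence N k k<N) square cross (F-sum N k (ℕ.<⇒≤ k<N)) }
    where
    open Squares (squares N k (ℕ.<⇒≤ k<N))
    m : ℤ
    m = + 2 * (+ k * (1ℤ + + k)) + 1ℤ + X
    algᶠ : ∀ k m S⁺ S S⁻ D F⁺ F → (1ℤ + k) * (1ℤ + k) * S⁺ + k * k * S⁻ ≡ m * S → S * S ≡ D →
      k * k * (S * S⁻) ≡ F → F⁺ + F ≡ m * D → (1ℤ + k) * (1ℤ + k) * (S⁺ * S) ≡ F⁺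
    algᶠ k m S⁺ S S⁻ D F⁺ F h hD hF hs = by (refl ⊞ S · h ⊞ m · hD ⊞ - 1ℤ · hF ⊞ - 1ℤ · hs)
      (solve (k ∷ m ∷ S⁺ ∷ S ∷ S⁻ ∷ D ∷ F⁺ ∷ F ∷ []))
    alg : ∀ k m S⁺ S S⁻ D⁺ D D⁻ F⁺ F G → (1ℤ + k) * (1ℤ + k) * S⁺ + k * k * S⁻ ≡ m * S →
      S * S ≡ D → S⁻ * S⁻ ≡ D⁻ → k * k * (S * S⁻) ≡ F → F⁺ + F ≡ m * D → F⁺ ≡ F + (+ 2 * k + 1ℤ) * G →
      (1ℤ + k) * (1ℤ + k) * ((1ℤ + k) * (1ℤ + k)) * D⁺ ≡ m * (+ 2 * k + 1ℤ) * G + k * k * (k * k) * D⁻ →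
      (1ℤ + k) * (1ℤ + k) * ((1ℤ + k) * (1ℤ + k) * (S⁺ * S⁺)) ≡ (1ℤ + k) * (1ℤ + k) * ((1ℤ + k) * (1ℤ + k) * D⁺)
    alg k m S⁺ S S⁻ D⁺ D D⁻ F⁺ F G h hD hD⁻ hF hs hd hr =
      by (refl ⊞ (1ℤ + k) * (1ℤ + k) * S⁺ + m * S - k * k * S⁻ · h ⊞ m * m · hD ⊞ k * k * (k * k) · hD⁻
               ⊞ - + 2 * m · hF ⊞ - m · hs ⊞ m · hd ⊞ - 1ℤ · hr)
         (solve (k ∷ m ∷ S⁺ ∷ S ∷ S⁻ ∷ D⁺ ∷ D ∷ D⁻ ∷ F⁺ ∷ F ∷ G ∷ []))

-- Squares of d

opaque
  unfolding c b

  p : ℕ → ℕ → ℤ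
  p i k = bin (k ℕ.+ i) (i ℕ.+ i)

  p-zero : ∀ k → p 0 k ≡ 1ℤ
  p-zero k = bin-zero (k ℕ.+ 0)

  p-raise : ∀ i k → + 2 * (+ 2 * + i + 1ℤ) * (1ℤ + + i) * p (suc i) k ≡ (+ k * (1ℤ + + k) - + i * (1ℤ + + i)) * p i k
  p-raise i k rewrite ℕ.+-suc k i | ℕ.+-suc i i =
    alg (+ i) (+ k) (bin (suc (k ℕ.+ i)) (suc (suc (i ℕ.+ i)))) (bin (k ℕ.+ i) (suc (i ℕ.+ i))) (bin (k ℕ.+ i) (i ℕ.+ i))
      (bin-absorb (k ℕ.+ i) (suc (i ℕ.+ i))) (bin-raise (k ℕ.+ i) (i ℕ.+ i))
    where
    alg : ∀ i k x y z → (1ℤ + (1ℤ + (i + i))) * x ≡ (1ℤ + (k + i)) * y → (1ℤ + (i + i)) * y ≡ (k + i - (i + i)) * z →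
      + 2 * (+ 2 * i + 1ℤ) * (1ℤ + i) * x ≡ (k * (1ℤ + k) - i * (1ℤ + i)) * z
    alg i k x y z h₁ h₂ = by (refl ⊞ + 2 * i + 1ℤ · h₁ ⊞ 1ℤ + (k + i) · h₂) (solve (i ∷ k ∷ x ∷ y ∷ z ∷ []))

  -- By `z-zero` and `z-suc` this is the sum of `b i l` over l < k.
  z : ℕ → ℕ → ℤ
  z i k = c i * bin (k ℕ.+ i) (suc (i ℕ.+ i))

  z-zero : ∀ i → z i 0 ≡ 0ℤ
  z-zero i = trans (cong (c i *_) (bin-< (ℕ.s≤s (ℕ.m≤m+n i i)))) (*-zeroʳ (c i))

-- Both sides are 1 at `i = 0` and obey the recurrence `b-raise` in `i`.
c*p≡b : ∀ i k → c i * p i k ≡ b i k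
c*p≡b zero    k = trans (cong₂ _*_ c-zero (p-zero k)) (sym (b-zero k))
c*p≡b (suc i) k = cancel² i (alg (+ i) (+ k * (1ℤ + + k)) (c i) (c (suc i)) (p i k) (p (suc i) k) (b i k) (b (suc i) k)
    (c*p≡b i k) (c-raise i) (p-raise i k) (b-raise i k))
  where
  alg : ∀ i τ c c⁺ p p⁺ b b⁺ → c * p ≡ b → (1ℤ + i) * c⁺ ≡ + 2 * (+ 2 * i + 1ℤ) * c →
    + 2 * (+ 2 * i + 1ℤ) * (1ℤ + i) * p⁺ ≡ (τ - i * (1ℤ + i)) * p →
    (1ℤ + i) * (1ℤ + i) * b⁺ ≡ (τ - i * (1ℤ + i)) * b →
    (1ℤ + i) * (1ℤ + i) * (c⁺ * p⁺) ≡ (1ℤ + i) * (1ℤ + i) * b⁺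
  alg i τ c c⁺ p p⁺ b b⁺ h hc hp hb =
    by (refl ⊞ τ - i * (1ℤ + i) · h ⊞ (1ℤ + i) * p⁺ · hc ⊞ c · hp ⊞ - 1ℤ · hb)
       (solve (i ∷ τ ∷ c ∷ c⁺ ∷ p ∷ p⁺ ∷ b ∷ b⁺ ∷ []))

opaque
  unfolding z p

  z-suc : ∀ i k → z i (suc k) ≡ z i k + b i k
  z-suc i k = alg (c i) (p i k) (b i k) (bin (suc (k ℕ.+ i)) (suc (i ℕ.+ i))) (bin (k ℕ.+ i) (suc (i ℕ.+ i)))
      (c*p≡b i k) (bin-pascal (k ℕ.+ i) (i ℕ.+ i))
    where
    alg : ∀ c p b x y → c * p ≡ b → x ≡ p + y → c * x ≡ c * y + b
    alg c p b x y h₁ h₂ = by (refl ⊞ 1ℤ · h₁ ⊞ c · h₂) (solve (c ∷ p ∷ b ∷ x ∷ y ∷ []))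

  z-b : ∀ i k → (+ 2 * + i + 1ℤ) * z i k ≡ (+ k - + i) * b i k
  z-b i k = alg (+ i) (+ k) (c i) (p i k) (b i k) (bin (k ℕ.+ i) (suc (i ℕ.+ i)))
      (c*p≡b i k) (bin-raise (k ℕ.+ i) (i ℕ.+ i))
    where
    alg : ∀ i k c p b y → c * p ≡ b → (1ℤ + (i + i)) * y ≡ (k + i - (i + i)) * p →
      (+ 2 * i + 1ℤ) * (c * y) ≡ (k - i) * b
    alg i k c p b y h₁ h₂ = by (refl ⊞ k - i · h₁ ⊞ c · h₂) (solve (i ∷ k ∷ c ∷ p ∷ b ∷ y ∷ []))

r : ℕ → ℕ → ℤ
r n i = (+ 4) ^ i * p i n

r-raise : ∀ n i → (1ℤ + + i) * (+ 2 * + i + 1ℤ) * r n (suc i) ≡ + 2 * (+ n * (1ℤ + + n) - + i * (1ℤ + + i)) * r n i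
r-raise n i = alg (+ i) (+ n * (1ℤ + + n)) ((+ 4) ^ i) (p i n) (p (suc i) n) (p-raise i n)
  where
  alg : ∀ i X q p p⁺ → + 2 * (+ 2 * i + 1ℤ) * (1ℤ + i) * p⁺ ≡ (X - i * (1ℤ + i)) * p →
    (1ℤ + i) * (+ 2 * i + 1ℤ) * (+ 4 * q * p⁺) ≡ + 2 * (X - i * (1ℤ + i)) * (q * p)
  alg i X q p p⁺ h = by (refl ⊞ + 2 * q · h) (solve (i ∷ X ∷ q ∷ p ∷ p⁺ ∷ []))

-- `u i` is the binomial coefficient of `x` over `i`, given through its recurrence so that `x` may
-- be negative. The coefficient 2x + 1 in `dₙ-recurrence` changes sign under x ↦ -1-x; hence `dₙ`
-- depends on `x` itself, while its square is expressed by `n`.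
module D-square (n : ℕ) (x : ℤ) (u : ℕ → ℤ) (u-zero : u 0 ≡ 1ℤ)
  (u-raise : ∀ i → (1ℤ + + i) * u (suc i) ≡ (x - + i) * u i)
  (x-n : x * (1ℤ + x) ≡ + n * (1ℤ + + n)) where

  X : ℤ
  X = + n * (1ℤ + + n)

  γ : ℕ → ℤ
  γ i = u i * (+ 2) ^ i

  γ-raise : ∀ i → (1ℤ + + i) * γ (suc i) ≡ + 2 * (x - + i) * γ i
  γ-raise i = alg (+ i) x (u i) (u (suc i)) ((+ 2) ^ i) (u-raise i)
    where
    alg : ∀ i x u u⁺ q → (1ℤ + i) * u⁺ ≡ (x - i) * u → (1ℤ + i) * (u⁺ * (+ 2 * q)) ≡ + 2 * (x - i) * (u * q)
    alg i x u u⁺ q h = by (refl ⊞ + 2 * q · h) (solve (i ∷ x ∷ u ∷ u⁺ ∷ q ∷ []))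

  dₙ : ℕ → ℕ → ℤ
  dₙ N k = ∑ N (λ i → bin k i * γ i)

  dₙ-recurrence : ∀ N k → suc k ℕ.< N →
    (1ℤ + + k) * dₙ N (suc k) ≡ (+ 2 * x + 1ℤ) * dₙ N k + + k * dₙ N (pred k)
  dₙ-recurrence N k k<N = begin
    (1ℤ + + k) * dₙ N (suc k)
      ≡⟨ ∑-*ˡ N (1ℤ + + k) _ ⟩
    ∑ N (λ i → (1ℤ + + k) * (bin (suc k) i * γ i))
      ≡⟨ sym (∑-telescope N _ _ V step refl Vₙ) ⟩
    ∑ N (λ i → (+ 2 * x + 1ℤ) * (bin k i * γ i) + + k * (bin (pred k) i * γ i))
      ≡⟨ sym (trans (cong₂ _+_ (∑-*ˡ N (+ 2 * x + 1ℤ) _) (∑-*ˡ N (+ k) _)) (∑-+ N _ _)) ⟩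
    (+ 2 * x + 1ℤ) * dₙ N k + + k * dₙ N (pred k) ∎
    where
    open ≡-Reasoning
    V : ℕ → ℤ
    V i = + i * (bin k (pred i) * γ i)
    Vₙ : V N ≡ 0ℤ
    Vₙ = trans (cong (λ y → + N * (y * γ N)) (bin-< (ℕ.<⇒≤pred k<N))) (*-zeroʳ (+ N))
    alg₀ : ∀ k x P P⁺ P⁻ g g⁺ → (1ℤ + 0ℤ) * g⁺ ≡ + 2 * (x - 0ℤ) * g → P⁺ ≡ 1ℤ → P ≡ 1ℤ → P⁻ ≡ 1ℤ →
      (+ 2 * x + 1ℤ) * (P * g) + k * (P⁻ * g) + 0ℤ ≡ (1ℤ + k) * (P⁺ * g) + (1ℤ + 0ℤ) * (P * g⁺)
    alg₀ k x P P⁺ P⁻ g g⁺ h refl refl refl = by (refl ⊞ - 1ℤ · h) (solve (k ∷ x ∷ g ∷ g⁺ ∷ []))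
    alg : ∀ k x j P Q R M g g⁺ → (1ℤ + (1ℤ + j)) * g⁺ ≡ + 2 * (x - (1ℤ + j)) * g →
      R ≡ P + Q → (1ℤ + j) * Q ≡ (k - j) * P → k * M ≡ (k - (1ℤ + j)) * Q →
      (+ 2 * x + 1ℤ) * (Q * g) + k * (M * g) + (1ℤ + j) * (P * g) ≡ (1ℤ + k) * (R * g) + (1ℤ + (1ℤ + j)) * (Q * g⁺)
    alg k x j P Q R M g g⁺ h h₁ h₂ h₃ = by (refl ⊞ - Q · h ⊞ - (1ℤ + k) * g · h₁ ⊞ g · h₂ ⊞ g · h₃)
      (solve (k ∷ x ∷ j ∷ P ∷ Q ∷ R ∷ M ∷ g ∷ g⁺ ∷ []))
    step : ∀ i → (+ 2 * x + 1ℤ) * (bin k i * γ i) + + k * (bin (pred k) i * γ i) + V i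
      ≡ (1ℤ + + k) * (bin (suc k) i * γ i) + V (suc i)
    step zero    = alg₀ (+ k) x (bin k 0) (bin (suc k) 0) (bin (pred k) 0) (γ 0) (γ 1) (γ-raise 0)
      (bin-zero _) (bin-zero _) (bin-zero _)
    step (suc j) = alg (+ k) x (+ j) (bin k j) (bin k (suc j)) (bin (suc k) (suc j)) (bin (pred k) (suc j))
      (γ (suc j)) (γ (suc (suc j))) (γ-raise (suc j)) (bin-pascal k j) (bin-raise k j) (bin-pred k (suc j))

  D : ℕ → ℕ → ℤ
  D N k = ∑ N (λ i → b i k * r n i)

  -- The sum of `D N l` over l < k. Multiplying `dₙ-recurrence` by d_k gives (k+1) d_{k+1} d_k =
  -- (2x+1) d_k² + k d_k d_{k-1}, so k d_k d_{k-1} is 2x + 1 times this sum.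
  S : ℕ → ℕ → ℤ
  S N k = ∑ N (λ i → z i k * r n i)

  S-suc : ∀ N k → S N (suc k) ≡ S N k + D N k
  S-suc N k = trans (∑-cong N λ i → trans (cong (_* r n i) (z-suc i k)) (alg (z i k) (b i k) (r n i))) (sym (∑-+ N _ _))
    where
    alg : ∀ a b c → (a + b) * c ≡ a * c + b * c
    alg = solve-∀

  -- Modelled on the square of `dₙ-recurrence`, where (2x+1)² = 4X + 1 and the mixed term 2 (2x+1) k
  -- d_k d_{k-1} becomes 2 (2x+1)² S_k.
  D-recurrence : ∀ N k → suc k ℕ.< N →
    (1ℤ + + k) * (1ℤ + + k) * D N (suc k) ≡ (+ 4 * X + 1ℤ) * (D N k + + 2 * S N k) + + k * + k * D N (pred k)
  D-recurrence N k k<N = begin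
    (1ℤ + + k) * (1ℤ + + k) * D N (suc k)
      ≡⟨ ∑-*ˡ N ((1ℤ + + k) * (1ℤ + + k)) _ ⟩
    ∑ N (λ i → (1ℤ + + k) * (1ℤ + + k) * (b i (suc k) * r n i))
      ≡⟨ sym (∑-telescope N _ _ V step refl Vₙ) ⟩
    ∑ N (λ i → (+ 4 * X + 1ℤ) * (b i k * r n i + + 2 * (z i k * r n i)) + + k * + k * (b i (pred k) * r n i))
      ≡⟨ sym (trans (cong₂ _+_ (trans (cong ((+ 4 * X + 1ℤ) *_)
             (trans (cong (λ y → D N k + y) (∑-*ˡ N (+ 2) _)) (∑-+ N _ _))) (∑-*ˡ N (+ 4 * X + 1ℤ) _))
           (∑-*ˡ N (+ k * + k) _)) (∑-+ N _ _)) ⟩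
    (+ 4 * X + 1ℤ) * (D N k + + 2 * S N k) + + k * + k * D N (pred k) ∎
    where
    open ≡-Reasoning
    V : ℕ → ℤ
    V i = + i * + i * ((b i (suc k) - b i (pred k)) * r n i)
    Vₙ : V N ≡ 0ℤ
    Vₙ = trans (cong₂ (λ y w → + N * + N * ((y - w) * r n N)) (b-< k<N)
      (b-< (ℕ.<-≤-trans (ℕ.s≤s (ℕ.pred[n]≤n {k})) (ℕ.<⇒≤ k<N)))) (*-zeroʳ (+ N * + N))
    alg : ∀ X k i b b⁺ b⁻ b₁⁺ b₁⁻ z r r⁺ →
      (1ℤ + k) * (1ℤ + k) * b⁺ ≡ i * i * b⁺ + (1ℤ + k + i) * (1ℤ + k + i) * b →
      k * k * b⁻ ≡ i * i * b⁻ + (k - i) * (k - i) * b →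
      (1ℤ + i) * (1ℤ + i) * b₁⁺ ≡ (+ 2 + k + i) * (1ℤ + k + i) * b →
      (1ℤ + i) * (1ℤ + i) * b₁⁻ ≡ (k - 1ℤ - i) * (k - i) * b →
      (+ 2 * i + 1ℤ) * z ≡ (k - i) * b →
      (1ℤ + i) * (+ 2 * i + 1ℤ) * r⁺ ≡ + 2 * (X - i * (1ℤ + i)) * r →
      (+ 4 * X + 1ℤ) * (b * r + + 2 * (z * r)) + k * k * (b⁻ * r) + i * i * ((b⁺ - b⁻) * r)
        ≡ (1ℤ + k) * (1ℤ + k) * (b⁺ * r) + (1ℤ + i) * (1ℤ + i) * ((b₁⁺ - b₁⁻) * r⁺)
    alg X k i b b⁺ b⁻ b₁⁺ b₁⁻ z r r⁺ h₁ h₂ h₃ h₄ h₅ h₆ =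
      by (refl ⊞ - r · h₁ ⊞ r · h₂ ⊞ - r⁺ · h₃ ⊞ r⁺ · h₄
               ⊞ + 2 * (+ 2 * i + 1ℤ) * r + + 4 * (1ℤ + i) * r⁺ · h₅ ⊞ - (+ 2 * b + + 4 * z) · h₆)
         (solve (X ∷ k ∷ i ∷ b ∷ b⁺ ∷ b⁻ ∷ b₁⁺ ∷ b₁⁻ ∷ z ∷ r ∷ r⁺ ∷ []))
    step : ∀ i → (+ 4 * X + 1ℤ) * (b i k * r n i + + 2 * (z i k * r n i)) + + k * + k * (b i (pred k) * r n i) + V i
      ≡ (1ℤ + + k) * (1ℤ + + k) * (b i (suc k) * r n i) + V (suc i)
    step i = alg X (+ k) (+ i) (b i k) (b i (suc k)) (b i (pred k)) (b (suc i) (suc k)) (b (suc i) (pred k))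
      (z i k) (r n i) (r n (suc i)) (b-square-up i k) (b-square-pred i k) (b-raise-up i k) (b-raise-pred i k)
      (z-b i k) (r-raise n i)

  record Squares (N k : ℕ) : Set where
    field
      square      : dₙ N k * dₙ N k ≡ D N k
      square-pred : dₙ N (pred k) * dₙ N (pred k) ≡ D N (pred k)
      cross       : + k * (dₙ N k * dₙ N (pred k)) ≡ (+ 2 * x + 1ℤ) * S N k

  squares : ∀ N k → k ℕ.< N → Squares N k
  squares (suc N) zero _ = record
    { square = base ; square-pred = base
    ; cross = sym (trans (cong ((+ 2 * x + 1ℤ) *_) (∑-zero (suc N) λ i → cong (_* r n i) (z-zero i))) (*-zeroʳ (+ 2 * x + 1ℤ))) }
    where
    d₀ : dₙ (suc N) 0 ≡ 1ℤ
    d₀ = trans (∑-head N _ λ i → cong (_* γ (suc i)) (bin-< {0} {suc i} (ℕ.s≤s ℕ.z≤n)))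
      (cong₂ _*_ (bin-zero 0) (cong (_* 1ℤ) u-zero))
    D₀ : D (suc N) 0 ≡ 1ℤ
    D₀ = trans (∑-head N _ λ i → cong (_* r n (suc i)) (b-< {suc i} {0} (ℕ.s≤s ℕ.z≤n)))
      (cong₂ _*_ (b-zero 0) (cong (1ℤ *_) (p-zero n)))
    base : dₙ (suc N) 0 * dₙ (suc N) 0 ≡ D (suc N) 0
    base = trans (cong₂ _*_ d₀ d₀) (sym D₀)
  squares N (suc k) k<N = record
    { square = cancel² k (alg (+ k) x X (dₙ N (suc k)) (dₙ N k) (dₙ N (pred k)) (D N (suc k)) (D N k) (D N (pred k)) (S N k)
        x-n (dₙ-recurrence N k k<N) square square-pred cross (D-recurrence N k k<N))
    ; square-pred = square
    ; cross = algˢ (+ k) x (dₙ N (suc k)) (dₙ N k) (dₙ N (pred k)) (D N k) (S N (suc k)) (S N k)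
        (dₙ-recurrence N k k<N) square cross (S-suc N k) }
    where
    open Squares (squares N k (ℕ.<⇒≤ k<N))
    algˢ : ∀ k x d⁺ d d⁻ D S⁺ S → (1ℤ + k) * d⁺ ≡ (+ 2 * x + 1ℤ) * d + k * d⁻ → d * d ≡ D →
      k * (d * d⁻) ≡ (+ 2 * x + 1ℤ) * S → S⁺ ≡ S + D → (1ℤ + k) * (d⁺ * d) ≡ (+ 2 * x + 1ℤ) * S⁺
    algˢ k x d⁺ d d⁻ D S⁺ S h hD hS hS⁺ = by (refl ⊞ d · h ⊞ + 2 * x + 1ℤ · hD ⊞ 1ℤ · hS ⊞ - (+ 2 * x + 1ℤ) · hS⁺)
      (solve (k ∷ x ∷ d⁺ ∷ d ∷ d⁻ ∷ D ∷ S⁺ ∷ S ∷ []))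
    alg : ∀ k x X d⁺ d d⁻ D⁺ D D⁻ S → x * (1ℤ + x) ≡ X → (1ℤ + k) * d⁺ ≡ (+ 2 * x + 1ℤ) * d + k * d⁻ →
      d * d ≡ D → d⁻ * d⁻ ≡ D⁻ → k * (d * d⁻) ≡ (+ 2 * x + 1ℤ) * S →
      (1ℤ + k) * (1ℤ + k) * D⁺ ≡ (+ 4 * X + 1ℤ) * (D + + 2 * S) + k * k * D⁻ →
      (1ℤ + k) * (1ℤ + k) * (d⁺ * d⁺) ≡ (1ℤ + k) * (1ℤ + k) * D⁺
    alg k x X d⁺ d d⁻ D⁺ D D⁻ S hX h hD hD⁻ hS hr =
      by (refl ⊞ + 4 * (D + + 2 * S) · hX ⊞ (1ℤ + k) * d⁺ + (+ 2 * x + 1ℤ) * d + k * d⁻ · h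
               ⊞ (+ 2 * x + 1ℤ) * (+ 2 * x + 1ℤ) · hD ⊞ k * k · hD⁻ ⊞ + 2 * (+ 2 * x + 1ℤ) · hS ⊞ - 1ℤ · hr)
         (solve (k ∷ x ∷ X ∷ d⁺ ∷ d ∷ d⁻ ∷ D⁺ ∷ D ∷ D⁻ ∷ S ∷ []))

-- The ℤ-span of the b i

-- Induction on `j`; for `j = 0` only the top term l = i survives. The step multiplies by k(k+1) -
-- j(j+1) = (k(k+1) - l(l+1)) + (l(l+1) - j(j+1)). On the l-th term the first part raises `b l` to
-- `b (suc l)`, and a shift of l leaves the identity of coefficients `K-step`.
b-product : ∀ i j k → b i k * b j k ≡ ∑ (suc (i ℕ.+ j)) (λ l → bin l i * bin l j * bin (i ℕ.+ j) l * b l k)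
b-product i zero k rewrite ℕ.+-identityʳ i = sym (trans (cong₂ _+_ (trans (∑-cong< i lower) (∑-zero i λ _ → refl)) top)
    (trans (+-identityˡ (1ℤ * b i k)) (trans (*-identityˡ (b i k)) (sym (trans (cong (b i k *_) (b-zero k)) (*-identityʳ (b i k)))))))
  where
  lower : ∀ l → l ℕ.< i → bin l i * bin l 0 * bin i l * b l k ≡ 0ℤ
  lower l l<i = cong (λ y → y * bin l 0 * bin i l * b l k) (bin-< l<i)
  top : bin i i * bin i 0 * bin i i * b i k ≡ 1ℤ * b i k
  top = cong (_* b i k) (cong₂ _*_ (cong₂ _*_ (bin-self i) (bin-zero i)) (bin-self i))
b-product i (suc j) k rewrite ℕ.+-suc i j = cancel² j (begin
  (1ℤ + + j) * (1ℤ + + j) * (b i k * b (suc j) k)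
    ≡⟨ alg₁ (+ j) (+ k * (1ℤ + + k)) (b i k) (b j k) (b (suc j) k) (b-raise j k) ⟩
  (+ k * (1ℤ + + k) - + j * (1ℤ + + j)) * (b i k * b j k)
    ≡⟨ cong ((+ k * (1ℤ + + k) - + j * (1ℤ + + j)) *_) (trans (b-product i j k) (sym extend)) ⟩
  (+ k * (1ℤ + + k) - + j * (1ℤ + + j)) * ∑ N (λ l → K l * b l k)
    ≡⟨ ∑-*ˡ N (+ k * (1ℤ + + k) - + j * (1ℤ + + j)) _ ⟩
  ∑ N (λ l → (+ k * (1ℤ + + k) - + j * (1ℤ + + j)) * (K l * b l k))
    ≡⟨ ∑-telescope N _ _ V step refl Vₙ ⟩
  ∑ N (λ l → (1ℤ + + j) * (1ℤ + + j) * (K⁺ l * b l k))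
    ≡⟨ sym (∑-*ˡ N ((1ℤ + + j) * (1ℤ + + j)) _) ⟩
  (1ℤ + + j) * (1ℤ + + j) * ∑ N (λ l → K⁺ l * b l k) ∎)
  where
  open ≡-Reasoning
  N : ℕ
  N = suc (suc (i ℕ.+ j))
  K K⁺ V : ℕ → ℤ
  K l = bin l i * bin l j * bin (i ℕ.+ j) l
  K⁺ l = bin l i * bin l (suc j) * bin (suc (i ℕ.+ j)) l
  V l = + l * + l * (K (pred l) * b l k)
  K-top : K (suc (i ℕ.+ j)) ≡ 0ℤ
  K-top = trans (cong (bin (suc (i ℕ.+ j)) i * bin (suc (i ℕ.+ j)) j *_) (bin-< ℕ.≤-refl))
    (*-zeroʳ (bin (suc (i ℕ.+ j)) i * bin (suc (i ℕ.+ j)) j))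
  -- The induction hypothesis sums up to i + j, the claim up to i + j + 1; the extra coefficient is
  -- zero.
  extend : ∑ N (λ l → K l * b l k) ≡ ∑ (suc (i ℕ.+ j)) (λ l → K l * b l k)
  extend = trans (cong (λ y → ∑ (suc (i ℕ.+ j)) (λ l → K l * b l k) + y) (cong (_* b (suc (i ℕ.+ j)) k) K-top)) (+-identityʳ _)
  Vₙ : V N ≡ 0ℤ
  Vₙ = trans (cong (λ y → + N * + N * (y * b N k)) K-top) (*-zeroʳ (+ N * + N))
  alg₁ : ∀ j τ x y y⁺ → (1ℤ + j) * (1ℤ + j) * y⁺ ≡ (τ - j * (1ℤ + j)) * y →
    (1ℤ + j) * (1ℤ + j) * (x * y⁺) ≡ (τ - j * (1ℤ + j)) * (x * y)
  alg₁ j τ x y y⁺ h = by (refl ⊞ x · h) (solve (j ∷ τ ∷ x ∷ y ∷ y⁺ ∷ []))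
  alg₂ : ∀ l j τ κ κ⁺ v b b⁺ → (1ℤ + l) * (1ℤ + l) * b⁺ ≡ (τ - l * (1ℤ + l)) * b →
    (l * (1ℤ + l) - j * (1ℤ + j)) * κ + v ≡ (1ℤ + j) * (1ℤ + j) * κ⁺ →
    (τ - j * (1ℤ + j)) * (κ * b) + v * b ≡ (1ℤ + j) * (1ℤ + j) * (κ⁺ * b) + (1ℤ + l) * (1ℤ + l) * (κ * b⁺)
  alg₂ l j τ κ κ⁺ v b b⁺ h₁ h₂ = by (refl ⊞ - κ · h₁ ⊞ b · h₂) (solve (l ∷ j ∷ τ ∷ κ ∷ κ⁺ ∷ v ∷ b ∷ b⁺ ∷ []))
  alg₃ : ∀ l i j A A⁻ B B⁻ B⁺ C C⁻ C⁺ → (1ℤ + l - i) * A ≡ (1ℤ + l) * A⁻ → (1ℤ + l - j) * B ≡ (1ℤ + l) * B⁻ →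
    (1ℤ + j) * B⁺ ≡ (1ℤ + l - j) * B → C⁺ ≡ C⁻ + C → (1ℤ + l) * C ≡ (i + j - l) * C⁻ →
    ((1ℤ + l) * (1ℤ + (1ℤ + l)) - j * (1ℤ + j)) * (A * B * C) + (1ℤ + l) * (1ℤ + l) * (A⁻ * B⁻ * C⁻)
      ≡ (1ℤ + j) * (1ℤ + j) * (A * B⁺ * C⁺)
  alg₃ l i j A A⁻ B B⁻ B⁺ C C⁻ C⁺ h₁ h₂ h₃ h₄ h₅ =
    by (refl ⊞ - (1ℤ + l) * B⁻ * C⁻ · h₁ ⊞ - (1ℤ + l - i) * A * C⁻ · h₂ ⊞ - (1ℤ + j) * A * C⁺ · h₃
             ⊞ - (1ℤ + j) * (1ℤ + l - j) * A * B · h₄ ⊞ (1ℤ + l - j) * A * B · h₅)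
       (solve (l ∷ i ∷ j ∷ A ∷ A⁻ ∷ B ∷ B⁻ ∷ B⁺ ∷ C ∷ C⁻ ∷ C⁺ ∷ []))
  j*bin : ∀ j → + j * bin 0 j ≡ 0ℤ
  j*bin zero    = refl
  j*bin (suc j) = trans (cong (+ suc j *_) (bin-< {0} {suc j} (ℕ.s≤s ℕ.z≤n))) (*-zeroʳ (+ suc j))
  alg₄ : ∀ j A B B⁺ C C⁺ → j * B ≡ 0ℤ → B⁺ ≡ 0ℤ →
    (0ℤ * (1ℤ + 0ℤ) - j * (1ℤ + j)) * (A * B * C) + 0ℤ ≡ (1ℤ + j) * (1ℤ + j) * (A * B⁺ * C⁺)
  alg₄ j A B B⁺ C C⁺ h₁ h₂ = by (refl ⊞ - (1ℤ + j) * A * C · h₁ ⊞ - (1ℤ + j) * (1ℤ + j) * A * C⁺ · h₂)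
    (solve (j ∷ A ∷ B ∷ B⁺ ∷ C ∷ C⁺ ∷ []))
  K-step : ∀ l → (+ l * (1ℤ + + l) - + j * (1ℤ + + j)) * K l + + l * + l * K (pred l) ≡ (1ℤ + + j) * (1ℤ + + j) * K⁺ l
  K-step zero    = alg₄ (+ j) (bin 0 i) (bin 0 j) (bin 0 (suc j)) (bin (i ℕ.+ j) 0) (bin (suc (i ℕ.+ j)) 0)
    (j*bin j) (bin-< {0} {suc j} (ℕ.s≤s ℕ.z≤n))
  K-step (suc l) = alg₃ (+ l) (+ i) (+ j) (bin (suc l) i) (bin l i) (bin (suc l) j) (bin l j) (bin (suc l) (suc j))
    (bin (i ℕ.+ j) (suc l)) (bin (i ℕ.+ j) l) (bin (suc (i ℕ.+ j)) (suc l))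
    (bin-up l i) (bin-up l j) (bin-raise (suc l) j) (bin-pascal (i ℕ.+ j) l) (bin-raise (i ℕ.+ j) l)
  step : ∀ l → (+ k * (1ℤ + + k) - + j * (1ℤ + + j)) * (K l * b l k) + V l
    ≡ (1ℤ + + j) * (1ℤ + + j) * (K⁺ l * b l k) + V (suc l)
  step l = trans (cong (λ y → (+ k * (1ℤ + + k) - + j * (1ℤ + + j)) * (K l * b l k) + y) (sym (*-assoc (+ l * + l) (K (pred l)) (b l k))))
    (alg₂ (+ l) (+ j) (+ k * (1ℤ + + k)) (K l) (K⁺ l) (+ l * + l * K (pred l)) (b l k) (b (suc l) k) (b-raise l k) (K-step l))

-- The pointwise equations in the constructors make membership invariant under pointwise equality.
-- Linear facts about the `b i` extend by recursion on the derivation.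
data Span : (ℕ → ℤ) → Set where
  scaled : ∀ {f} a i → (∀ k → f k ≡ a * b i k) → Span f
  sum    : ∀ {f g h} → Span f → Span g → (∀ k → h k ≡ f k + g k) → Span h

span-cong : ∀ {f g} → (∀ k → g k ≡ f k) → Span f → Span g
span-cong eq (scaled a i h) = scaled a i λ k → trans (eq k) (h k)
span-cong eq (sum p q h)    = sum p q λ k → trans (eq k) (h k)

span-scale : ∀ {f} a → Span f → Span (λ k → a * f k)
span-scale a (scaled a′ i h) = scaled (a * a′) i λ k → trans (cong (a *_) (h k)) (sym (*-assoc a a′ (b i k)))
span-scale a (sum p q h)     = sum (span-scale a p) (span-scale a q) λ k →
  trans (cong (a *_) (h k)) (*-distribˡ-+ a _ _)

span-∑ : ∀ n {f : ℕ → ℕ → ℤ} → (∀ i → Span (f i)) → Span (λ k → ∑ n (λ i → f i k))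
span-∑ zero    p = scaled 0ℤ 0 λ k → refl
span-∑ (suc n) p = sum (span-∑ n p) (p n) λ k → refl

span-* : ∀ {f g} → Span f → Span g → Span (λ k → f k * g k)
span-* (scaled a i h) (scaled a′ j h′) = span-cong
    (λ k → trans (cong₂ _*_ (h k) (h′ k)) (trans (alg a a′ (b i k) (b j k)) (cong (a * a′ *_) (b-product i j k))))
    (span-scale (a * a′) (span-∑ (suc (i ℕ.+ j)) λ l → scaled (bin l i * bin l j * bin (i ℕ.+ j) l) l λ k → refl))
  where
  alg : ∀ a a′ x y → a * x * (a′ * y) ≡ a * a′ * (x * y)
  alg = solve-∀
span-* {f} p@(scaled _ _ _) (sum q q′ h) = sum (span-* p q) (span-* p q′) λ k →
  trans (cong (f k *_) (h k)) (*-distribˡ-+ (f k) _ _)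
span-* {g = g} (sum {f₁} {f₂} p p′ h) q = sum (span-* p q) (span-* p′ q) λ k →
  trans (cong (_* g k) (h k)) (*-distribʳ-+ (g k) (f₁ k) (f₂ k))

span-^ : ∀ {f} → Span f → ∀ m → Span (λ k → f k ^ m)
span-^ p zero    = scaled 1ℤ 0 λ k → sym (trans (*-identityˡ _) (b-zero k))
span-^ p (suc m) = span-* p (span-^ p m)

-- Sums of bᵢ(k) with weights 2k + 1 and (-1)ᵏ (2k + 1)

w : ℕ → ℕ → ℤ
w i n = bin (pred n) i * bin (n ℕ.+ i) i

[n-i]b≡nw : ∀ i n → (+ n - + i) * b i n ≡ + n * w i n
[n-i]b≡nw i n = alg (+ n) (+ i) (b i n) (bin n i) (bin (pred n) i) (bin (n ℕ.+ i) i) (b-def i n) (bin-pred n i)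
  where
  alg : ∀ n i b x x⁻ y → b ≡ x * y → n * x⁻ ≡ (n - i) * x → (n - i) * b ≡ n * (x⁻ * y)
  alg n i b x x⁻ y h₁ h₂ = by (refl ⊞ n - i · h₁ ⊞ - y · h₂) (solve (n ∷ i ∷ b ∷ x ∷ x⁻ ∷ y ∷ []))

odd-sum : ∀ i n → (1ℤ + + i) * ∑ n (λ k → (+ 2 * + k + 1ℤ) * b i k) ≡ + n * (+ n - + i) * b i n
odd-sum i zero    = *-zeroʳ (1ℤ + + i)
odd-sum i (suc n) = alg (+ i) (+ n) (∑ n (λ k → (+ 2 * + k + 1ℤ) * b i k)) (b i n) (b i (suc n)) (odd-sum i n) (b-up i n)
  where
  alg : ∀ i n s b b⁺ → (1ℤ + i) * s ≡ n * (n - i) * b → (1ℤ + n - i) * b⁺ ≡ (1ℤ + n + i) * b →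
    (1ℤ + i) * (s + (+ 2 * n + 1ℤ) * b) ≡ (1ℤ + n) * (1ℤ + n - i) * b⁺
  alg i n s b b⁺ h₁ h₂ = by (refl ⊞ 1ℤ · h₁ ⊞ - (1ℤ + n) · h₂) (solve (i ∷ n ∷ s ∷ b ∷ b⁺ ∷ []))

-- The factor n - i of `odd-sum` supplies the second n; the denominator i + 1 is left to the
-- coefficients.
odd-sum-n² : ∀ i n → (1ℤ + + i) * ∑ n (λ k → (+ 2 * + k + 1ℤ) * b i k) ≡ + n * + n * w i n
odd-sum-n² i n = trans (odd-sum i n) (trans (*-assoc (+ n) _ _)
  (trans (cong (+ n *_) ([n-i]b≡nw i n)) (sym (*-assoc (+ n) (+ n) _))))

-- Here n - i cancels the denominator instead, as (n-i) C(n,i) = (i+1) C(n,i+1), at the price of a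
-- single factor n.
odd-sum-n : ∀ i n → ∑ n (λ k → (+ 2 * + k + 1ℤ) * b i k) ≡ + n * (bin n (suc i) * bin (n ℕ.+ i) i)
odd-sum-n i n = cancel i (alg (+ n) (+ i) (∑ n (λ k → (+ 2 * + k + 1ℤ) * b i k)) (b i n) (bin n i) (bin n (suc i)) (bin (n ℕ.+ i) i)
    (odd-sum i n) (b-def i n) (bin-raise n i))
  where
  alg : ∀ n i s b x x⁺ y → (1ℤ + i) * s ≡ n * (n - i) * b → b ≡ x * y → (1ℤ + i) * x⁺ ≡ (n - i) * x →
    (1ℤ + i) * s ≡ (1ℤ + i) * (n * (x⁺ * y))
  alg n i s b x x⁺ y h₁ h₂ h₃ = by (refl ⊞ 1ℤ · h₁ ⊞ n * (n - i) · h₂ ⊞ - n * y · h₃)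
    (solve (n ∷ i ∷ s ∷ b ∷ x ∷ x⁺ ∷ y ∷ []))

-- `- (- 1ℤ) ^ n` is (-1)ⁿ⁻¹ in a form meaningful at `n = 0`. The sum telescopes by `b-up`, because
-- (n - i) + (n + 1 + i) = 2n + 1.
alternating-sum : ∀ i n → ∑ n (λ k → (- 1ℤ) ^ k * (+ 2 * + k + 1ℤ) * b i k) ≡ + n * (- (- 1ℤ) ^ n * w i n)
alternating-sum i n = trans (go n) (trans (cong (- (- 1ℤ) ^ n *_) ([n-i]b≡nw i n)) (alg (- (- 1ℤ) ^ n) (+ n) (w i n)))
  where
  alg : ∀ s n w → s * (n * w) ≡ n * (s * w)
  alg = solve-∀
  alg₀ : ∀ i b → i * b ≡ 0ℤ → 0ℤ ≡ - 1ℤ * ((0ℤ - i) * b)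
  alg₀ i b h = by (refl ⊞ - 1ℤ · h) (solve (i ∷ b ∷ []))
  algˢ : ∀ i n s q b b⁺ → s ≡ - q * ((n - i) * b) → (1ℤ + n - i) * b⁺ ≡ (1ℤ + n + i) * b →
    s + q * (+ 2 * n + 1ℤ) * b ≡ - (- 1ℤ * q) * ((1ℤ + n - i) * b⁺)
  algˢ i n s q b b⁺ h₁ h₂ = by (refl ⊞ 1ℤ · h₁ ⊞ - q · h₂) (solve (i ∷ n ∷ s ∷ q ∷ b ∷ b⁺ ∷ []))
  go : ∀ n → ∑ n (λ k → (- 1ℤ) ^ k * (+ 2 * + k + 1ℤ) * b i k) ≡ - (- 1ℤ) ^ n * ((+ n - + i) * b i n)
  go zero    = alg₀ (+ i) (b i 0) (i*bᵢ0≡0 i)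
  go (suc n) = algˢ (+ i) (+ n) (∑ n (λ k → (- 1ℤ) ^ k * (+ 2 * + k + 1ℤ) * b i k)) ((- 1ℤ) ^ n) (b i n) (b i (suc n)) (go n) (b-up i n)

-- The weights `a` are left general to serve both the plain and the alternating sums.
span-sum : ∀ (a : ℕ → ℤ) n → (∀ i → ∃ λ y → ∑ n (λ k → a k * b i k) ≡ + n * y) →
  ∀ {f} → Span f → ∃ λ y → ∑ n (λ k → a k * f k) ≡ + n * y
span-sum a n base (scaled q i h) with base i
... | y , eq = q * y , trans (∑-cong n λ k → trans (cong (a k *_) (h k)) (alg (a k) q (b i k)))
    (trans (sym (∑-*ˡ n q (λ k → a k * b i k))) (trans (cong (q *_) eq) (alg q (+ n) y)))
  where
  alg : ∀ s n w → s * (n * w) ≡ n * (s * w)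
  alg = solve-∀
span-sum a n base (sum p p′ h) with span-sum a n base p | span-sum a n base p′
... | y , eq | y′ , eq′ = y + y′ , trans (∑-cong n λ k → trans (cong (a k *_) (h k)) (*-distribˡ-+ (a k) _ _))
    (trans (sym (∑-+ n _ _)) (trans (cong₂ _+_ eq eq′) (sym (*-distribˡ-+ (+ n) y y′))))

-- After an exchange of sums, the factor i + 1 of `a i` meets the one in `odd-sum-n²`. This
-- condition on coefficients is checked for the closed forms of the squares, not for general
-- elements of `Span`.
n²-divides : ∀ n N (a : ℕ → ℤ) → (∀ i → ∃ λ y → a i ≡ (1ℤ + + i) * y) →
  ∃ λ y → ∑ n (λ k → (+ 2 * + k + 1ℤ) * ∑ N (λ i → b i k * a i)) ≡ + n * + n * y
n²-divides n N a div = ∑ N (λ i → proj₁ (div i) * w i n) , (begin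
  ∑ n (λ k → (+ 2 * + k + 1ℤ) * ∑ N (λ i → b i k * a i))
    ≡⟨ ∑-cong n (λ k → ∑-*ˡ N (+ 2 * + k + 1ℤ) (λ i → b i k * a i)) ⟩
  ∑ n (λ k → ∑ N (λ i → (+ 2 * + k + 1ℤ) * (b i k * a i)))
    ≡⟨ ∑-swap n N _ ⟩
  ∑ N (λ i → ∑ n (λ k → (+ 2 * + k + 1ℤ) * (b i k * a i)))
    ≡⟨ ∑-cong N (λ i → trans (∑-cong n (λ k → algᵏ (+ 2 * + k + 1ℤ) (b i k) (a i)))
         (sym (∑-*ˡ n (a i) (λ k → (+ 2 * + k + 1ℤ) * b i k)))) ⟩
  ∑ N (λ i → a i * ∑ n (λ k → (+ 2 * + k + 1ℤ) * b i k))
    ≡⟨ ∑-cong N (λ i → alg (+ i) (+ n) (a i) (proj₁ (div i)) _ (w i n) (proj₂ (div i)) (odd-sum-n² i n)) ⟩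
  ∑ N (λ i → + n * + n * (proj₁ (div i) * w i n))
    ≡⟨ sym (∑-*ˡ N (+ n * + n) (λ i → proj₁ (div i) * w i n)) ⟩
  + n * + n * ∑ N (λ i → proj₁ (div i) * w i n) ∎)
  where
  open ≡-Reasoning
  algᵏ : ∀ o b a → o * (b * a) ≡ a * (o * b)
  algᵏ = solve-∀
  alg : ∀ i n a y s w → a ≡ (1ℤ + i) * y → (1ℤ + i) * s ≡ n * n * w → a * s ≡ n * n * (y * w)
  alg i n a y s w h₁ h₂ = by (refl ⊞ s · h₁ ⊞ y · h₂) (solve (i ∷ n ∷ a ∷ y ∷ s ∷ w ∷ []))

-- From ℤ to ℚ

-- `_/_` divides by a gcd that does not evaluate on variables. The laws of `ℤ→ℚ` are therefore
-- checked on unnormalised fractions, where they are integer identities.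
toℚᵘ-ι : ∀ a → toℚᵘ (ℤ→ℚ a) ℚᵘ.≃ mkℚᵘ a 0
toℚᵘ-ι a = ℚ.toℚᵘ-fromℚᵘ (mkℚᵘ a 0)

ι-+ : ∀ a b → ℤ→ℚ a ℚ.+ ℤ→ℚ b ≡ ℤ→ℚ (a + b)
ι-+ a b = ℚ.toℚᵘ-injective (begin
  toℚᵘ (ℤ→ℚ a ℚ.+ ℤ→ℚ b)             ≈⟨ ℚ.toℚᵘ-homo-+ (ℤ→ℚ a) (ℤ→ℚ b) ⟩
  toℚᵘ (ℤ→ℚ a) ℚᵘ.+ toℚᵘ (ℤ→ℚ b)     ≈⟨ ℚᵘ.+-cong (toℚᵘ-ι a) (toℚᵘ-ι b) ⟩
  mkℚᵘ a 0 ℚᵘ.+ mkℚᵘ b 0              ≈⟨ *≡* (alg a b) ⟩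
  mkℚᵘ (a + b) 0                      ≈⟨ ℚᵘ.≃-sym (toℚᵘ-ι (a + b)) ⟩
  toℚᵘ (ℤ→ℚ (a + b))                  ∎)
  where
  open SetoidReasoning ℚᵘ.≃-setoid
  alg : ∀ a b → (a * 1ℤ + b * 1ℤ) * 1ℤ ≡ (a + b) * 1ℤ
  alg = solve-∀

ι-* : ∀ a b → ℤ→ℚ a ℚ.* ℤ→ℚ b ≡ ℤ→ℚ (a * b)
ι-* a b = ℚ.toℚᵘ-injective (begin
  toℚᵘ (ℤ→ℚ a ℚ.* ℤ→ℚ b)             ≈⟨ ℚ.toℚᵘ-homo-* (ℤ→ℚ a) (ℤ→ℚ b) ⟩
  toℚᵘ (ℤ→ℚ a) ℚᵘ.* toℚᵘ (ℤ→ℚ b)     ≈⟨ ℚᵘ.*-cong (toℚᵘ-ι a) (toℚᵘ-ι b) ⟩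
  mkℚᵘ a 0 ℚᵘ.* mkℚᵘ b 0              ≈⟨ *≡* refl ⟩
  mkℚᵘ (a * b) 0                      ≈⟨ ℚᵘ.≃-sym (toℚᵘ-ι (a * b)) ⟩
  toℚᵘ (ℤ→ℚ (a * b))                  ∎)
  where open SetoidReasoning ℚᵘ.≃-setoid

ι-neg : ∀ a → ℚ.- ℤ→ℚ a ≡ ℤ→ℚ (- a)
ι-neg a = ℚ.toℚᵘ-injective (begin
  toℚᵘ (ℚ.- ℤ→ℚ a)      ≈⟨ ℚ.toℚᵘ-homo‿- (ℤ→ℚ a) ⟩
  ℚᵘ.- toℚᵘ (ℤ→ℚ a)     ≈⟨ ℚᵘ.-‿cong (toℚᵘ-ι a) ⟩
  ℚᵘ.- mkℚᵘ a 0          ≈⟨ *≡* refl ⟩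
  mkℚᵘ (- a) 0           ≈⟨ ℚᵘ.≃-sym (toℚᵘ-ι (- a)) ⟩
  toℚᵘ (ℤ→ℚ (- a))       ∎)
  where open SetoidReasoning ℚᵘ.≃-setoid

1/n*ι[n*a] : ∀ n .{{_ : NonZero n}} a → ((+ 1) ℚ./ n) ℚ.* ℤ→ℚ (+ n * a) ≡ ℤ→ℚ a
1/n*ι[n*a] n@(suc n-1) a = ℚ.toℚᵘ-injective (begin
  toℚᵘ (((+ 1) ℚ./ n) ℚ.* ℤ→ℚ (+ n * a))             ≈⟨ ℚ.toℚᵘ-homo-* ((+ 1) ℚ./ n) (ℤ→ℚ (+ n * a)) ⟩
  toℚᵘ ((+ 1) ℚ./ n) ℚᵘ.* toℚᵘ (ℤ→ℚ (+ n * a))       ≈⟨ ℚᵘ.*-cong (ℚ.toℚᵘ-fromℚᵘ (mkℚᵘ (+ 1) n-1)) (toℚᵘ-ι (+ n * a)) ⟩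
  mkℚᵘ (+ 1) n-1 ℚᵘ.* mkℚᵘ (+ n * a) 0                ≈⟨ *≡* (alg (+ n) a) ⟩
  mkℚᵘ a 0                                            ≈⟨ ℚᵘ.≃-sym (toℚᵘ-ι a) ⟩
  toℚᵘ (ℤ→ℚ a)                                        ∎)
  where
  open SetoidReasoning ℚᵘ.≃-setoid
  alg : ∀ n a → (+ 1 * (n * a)) * 1ℤ ≡ a * (n * 1ℤ)
  alg = solve-∀

ι-^ : ∀ a m → ℤ→ℚ a ^ℚ m ≡ ℤ→ℚ (a ^ m)
ι-^ a zero    = refl
ι-^ a (suc m) = trans (cong (ℤ→ℚ a ℚ.*_) (ι-^ a m)) (ι-* a (a ^ m))

Σ<-ι : ∀ n {f : ℕ → ℚ} (g : ℕ → ℤ) → (∀ i → i ℕ.< n → f i ≡ ℤ→ℚ (g i)) → Σ< n f ≡ ℤ→ℚ (∑ n g)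
Σ<-ι zero    g eq = refl
Σ<-ι (suc n) g eq = trans (cong₂ ℚ._+_ (Σ<-ι n g λ i i<n → eq i (ℕ.m<n⇒m<1+n i<n)) (eq n ℕ.≤-refl)) (ι-+ (∑ n g) (g n))

-- Falling factorials and values at integers of either sign

fall : ℤ → ℕ → ℤ
fall x zero    = 1ℤ
fall x (suc i) = fall x i * (x - + i)

falling-ι : ∀ x i → falling (ℤ→ℚ x) i ≡ ℤ→ℚ (fall x i)
falling-ι x zero    = refl
falling-ι x (suc i) = trans (cong₂ ℚ._*_ (falling-ι x i) (trans (cong (ℤ→ℚ x ℚ.+_) (ι-neg (+ i))) (ι-+ x (- + i))))
  (ι-* (fall x i) (x - + i))

-- Splits off the first factor instead of the last, as required in `fall*fall`, where the base x + i
-- moves with i.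
fall-suc : ∀ x i → fall (1ℤ + x) (suc i) ≡ (1ℤ + x) * fall x i
fall-suc x zero    = alg x
  where
  alg : ∀ x → 1ℤ * (1ℤ + x - 0ℤ) ≡ (1ℤ + x) * 1ℤ
  alg = solve-∀
fall-suc x (suc i) = trans (cong (_* (1ℤ + x - + suc i)) (fall-suc x i)) (alg x (+ i) (fall x i))
  where
  alg : ∀ x i f → (1ℤ + x) * f * (1ℤ + x - (1ℤ + i)) ≡ (1ℤ + x) * (f * (x - i))
  alg = solve-∀

-- Here x = n or x = −1 − n, and u i is the value of binom x i.
record Reflection (x : ℤ) : Set where
  field
    n       : ℕ
    x-n     : x * (1ℤ + x) ≡ + n * (1ℤ + + n)
    u       : ℕ → ℤ
    u-zero  : u 0 ≡ 1ℤ
    u-raise : ∀ i → (1ℤ + + i) * u (suc i) ≡ (x - + i) * u i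

reflect : ∀ x → Reflection x
reflect (+ n) = record { n = n ; x-n = refl ; u = bin n ; u-zero = bin-zero n ; u-raise = bin-raise n }
reflect -[1+ n ] = record
  { n = n ; x-n = alg (+ n) ; u = u ; u-zero = trans (*-identityˡ _) (bin-zero (n ℕ.+ 0)) ; u-raise = u-raise }
  where
  alg : ∀ n → - (1ℤ + n) * (1ℤ + - (1ℤ + n)) ≡ n * (1ℤ + n)
  alg = solve-∀
  -- Upper negation: the binomial coefficient of -1-n over i is (-1)ⁱ C(n+i,i).
  u : ℕ → ℤ
  u i = (- 1ℤ) ^ i * bin (n ℕ.+ i) i
  algᵘ : ∀ n i q x y → (1ℤ + i) * y ≡ (1ℤ + (n + i)) * x → (1ℤ + i) * (- 1ℤ * q * y) ≡ (- (1ℤ + n) - i) * (q * x)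
  algᵘ n i q x y h = by (refl ⊞ - q · h) (solve (n ∷ i ∷ q ∷ x ∷ y ∷ []))
  u-raise : ∀ i → (1ℤ + + i) * u (suc i) ≡ (-[1+ n ] - + i) * u i
  u-raise i rewrite ℕ.+-suc n i =
    algᵘ (+ n) (+ i) ((- 1ℤ) ^ i) (bin (n ℕ.+ i) i) (bin (suc (n ℕ.+ i)) (suc i)) (bin-absorb (n ℕ.+ i) i)

module Values {x : ℤ} (ρ : Reflection x) where
  open Reflection ρ

  fall≡i!*u : ∀ i → fall x i ≡ + (i !) * u i
  fall≡i!*u zero    = sym (trans (*-identityˡ (u 0)) u-zero)
  fall≡i!*u (suc i) = alg x (+ i) (+ (i !)) (+ (suc i !)) (fall x i) (u i) (u (suc i))
      (fall≡i!*u i) (pos-* (suc i) (i !)) (u-raise i)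
    where
    alg : ∀ x i q q⁺ f u u⁺ → f ≡ q * u → q⁺ ≡ (1ℤ + i) * q → (1ℤ + i) * u⁺ ≡ (x - i) * u → f * (x - i) ≡ q⁺ * u⁺
    alg x i q q⁺ f u u⁺ h₁ h₂ h₃ = by (refl ⊞ x - i · h₁ ⊞ - u⁺ · h₂ ⊞ - q · h₃)
      (solve (x ∷ i ∷ q ∷ q⁺ ∷ f ∷ u ∷ u⁺ ∷ []))

  -- Each step contributes (x - i)(x + i + 1) = x(x+1) - i(i+1), the factor in `b-raise`; so `x` may
  -- be replaced by `n` although the two falling factorials separately may differ from those of `n`.
  fall*fall : ∀ i → fall x i * fall (x + + i) i ≡ + (i !) * (+ (i !) * b i n)
  fall*fall zero    = sym (trans (*-identityˡ (1ℤ * b 0 n)) (trans (*-identityˡ (b 0 n)) (b-zero n)))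
  fall*fall (suc i) = alg x (+ n * (1ℤ + + n)) (+ i) (+ (i !)) (+ (suc i !)) (fall x i) (fall (x + + i) i)
      (fall (x + + suc i) (suc i)) (b i n) (b (suc i) n)
      (fall*fall i) (pos-* (suc i) (i !)) (b-raise i n) x-n
      (trans (cong (λ y → fall y (suc i)) (algˢ x (+ i))) (fall-suc (x + + i) i))
    where
    algˢ : ∀ x i → x + (1ℤ + i) ≡ 1ℤ + (x + i)
    algˢ = solve-∀
    alg : ∀ x X i q q⁺ f g g⁺ b b⁺ → f * g ≡ q * (q * b) → q⁺ ≡ (1ℤ + i) * q →
      (1ℤ + i) * (1ℤ + i) * b⁺ ≡ (X - i * (1ℤ + i)) * b → x * (1ℤ + x) ≡ X → g⁺ ≡ (1ℤ + (x + i)) * g →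
      f * (x - i) * g⁺ ≡ q⁺ * (q⁺ * b⁺)
    alg x X i q q⁺ f g g⁺ b b⁺ h₁ refl h₃ refl refl =
      by (refl ⊞ (x - i) * (1ℤ + (x + i)) · h₁ ⊞ - (q * q) · h₃) (solve (x ∷ i ∷ q ∷ f ∷ g ∷ b ∷ b⁺ ∷ []))

  binom-ι : ∀ i → binom (ℤ→ℚ x) i ≡ ℤ→ℚ (u i)
  binom-ι i = trans (cong (ℚ._* h) (trans (falling-ι x i) (cong ℤ→ℚ (fall≡i!*u i))))
    (trans (ℚ.*-comm (ℤ→ℚ (+ (i !) * u i)) h) (1/n*ι[n*a] (i !) {{i ℕ.!≢0}} (u i)))
    where
    h : ℚ
    h = ((+ 1) ℚ./ (i !)) {{i ℕ.!≢0}}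

  binom*binom-ι : ∀ i → binom (ℤ→ℚ x) i ℚ.* binom (ℤ→ℚ x ℚ.+ ℕ→ℚ i) i ≡ ℤ→ℚ (b i n)
  binom*binom-ι i = begin
    (falling (ℤ→ℚ x) i ℚ.* h) ℚ.* (falling (ℤ→ℚ x ℚ.+ ℕ→ℚ i) i ℚ.* h)
      ≡⟨ cong₂ (λ p q → (p ℚ.* h) ℚ.* (q ℚ.* h)) (falling-ι x i)
           (trans (cong (λ y → falling y i) (ι-+ x (+ i))) (falling-ι (x + + i) i)) ⟩
    (ℤ→ℚ f ℚ.* h) ℚ.* (ℤ→ℚ g ℚ.* h)
      ≡⟨ cong₂ ℚ._*_ (ℚ.*-comm (ℤ→ℚ f) h) (ℚ.*-comm (ℤ→ℚ g) h) ⟩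
    (h ℚ.* ℤ→ℚ f) ℚ.* (h ℚ.* ℤ→ℚ g)
      ≡⟨ ℚ.*-assoc h (ℤ→ℚ f) (h ℚ.* ℤ→ℚ g) ⟩
    h ℚ.* (ℤ→ℚ f ℚ.* (h ℚ.* ℤ→ℚ g))
      ≡⟨ cong (h ℚ.*_) (trans (sym (ℚ.*-assoc (ℤ→ℚ f) h (ℤ→ℚ g)))
           (trans (cong (ℚ._* ℤ→ℚ g) (ℚ.*-comm (ℤ→ℚ f) h)) (ℚ.*-assoc h (ℤ→ℚ f) (ℤ→ℚ g)))) ⟩
    h ℚ.* (h ℚ.* (ℤ→ℚ f ℚ.* ℤ→ℚ g))
      ≡⟨ cong (λ y → h ℚ.* (h ℚ.* y)) (trans (ι-* f g) (cong ℤ→ℚ (fall*fall i))) ⟩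
    h ℚ.* (h ℚ.* ℤ→ℚ (+ (i !) * (+ (i !) * b i n)))
      ≡⟨ cong (h ℚ.*_) (1/n*ι[n*a] (i !) {{i ℕ.!≢0}} (+ (i !) * b i n)) ⟩
    h ℚ.* ℤ→ℚ (+ (i !) * b i n)
      ≡⟨ 1/n*ι[n*a] (i !) {{i ℕ.!≢0}} (b i n) ⟩
    ℤ→ℚ (b i n) ∎
    where
    open ≡-Reasoning
    h : ℚ
    h = ((+ 1) ℚ./ (i !)) {{i ℕ.!≢0}}
    f g : ℤ
    f = fall x i
    g = fall (x + + i) i

  module Dq = D-square n x u u-zero u-raise x-n
  module Sq = S-square n

  bin-∑-extend : ∀ {N k} (f : ℕ → ℤ) → k ℕ.< N → ∑ N (λ i → bin k i * f i) ≡ ∑ (suc k) (λ i → bin k i * f i)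
  bin-∑-extend f k<N = ∑-extend _ (ℕ.≤⇒≤′ k<N) λ i k<i → cong (_* f i) (bin-< k<i)

  d-ι : ∀ {N k} → k ℕ.< N → d k (ℤ→ℚ x) ≡ ℤ→ℚ (Dq.dₙ N k)
  d-ι {N} {k} k<N = trans (Σ<-ι (suc k) (λ i → bin k i * Dq.γ i) λ i _ → term i) (cong ℤ→ℚ (sym (bin-∑-extend Dq.γ k<N)))
    where
    term : ∀ i → ℕ→ℚ (k C i) ℚ.* binom (ℤ→ℚ x) i ℚ.* (ℕ→ℚ 2 ^ℚ i) ≡ ℤ→ℚ (bin k i * Dq.γ i)
    term i = trans (cong₂ ℚ._*_ (trans (cong₂ ℚ._*_ (cong ℤ→ℚ (sym (bin-C k i))) (binom-ι i)) (ι-* (bin k i) (u i))) (ι-^ (+ 2) i))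
      (trans (ι-* (bin k i * u i) ((+ 2) ^ i)) (cong ℤ→ℚ (*-assoc (bin k i) (u i) ((+ 2) ^ i))))

  s-ι : ∀ {N k} → k ℕ.< N → s k (ℤ→ℚ x) ≡ ℤ→ℚ (Sq.sₙ N k)
  s-ι {N} {k} k<N = trans (Σ<-ι (suc k) (λ i → bin k i * b i n) λ i _ → term i) (cong ℤ→ℚ (sym (bin-∑-extend (λ i → b i n) k<N)))
    where
    term : ∀ i → ℕ→ℚ (k C i) ℚ.* binom (ℤ→ℚ x) i ℚ.* binom (ℤ→ℚ x ℚ.+ ℕ→ℚ i) i ≡ ℤ→ℚ (bin k i * b i n)
    term i = trans (ℚ.*-assoc (ℕ→ℚ (k C i)) _ _)
      (trans (cong₂ ℚ._*_ (cong ℤ→ℚ (sym (bin-C k i))) (binom*binom-ι i)) (ι-* (bin k i) (b i n)))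

-- Even powers and the six quotients

ι-odd : ∀ k → ℕ→ℚ (2 ℕ.* k ℕ.+ 1) ≡ ℤ→ℚ (+ 2 * + k + 1ℤ)
ι-odd k = cong (λ y → ℤ→ℚ (y + 1ℤ)) (pos-* 2 k)

even-power : ∀ a m → a ^ (2 ℕ.* m) ≡ (a * a) ^ m
even-power a m = trans (sym (^-*-assoc a 2 m)) (cong (λ y → (a * y) ^ m) (*-identityʳ a))

-- `f` holds the integer values of `F`, and `g` the closed form of their squares. Agreement is asked
-- for `k < n` because the closed forms used are truncated at `n`.
module EvenPowers (n : ℕ) {{_ : NonZero n}} (F : ℕ → ℚ) (f g : ℕ → ℤ)
  (F-f : ∀ k → k ℕ.< n → F k ≡ ℤ→ℚ (f k)) (f²-g : ∀ k → k ℕ.< n → f k * f k ≡ g k) where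

  power : ∀ m k → k ℕ.< n → F k ^ℚ (2 ℕ.* m) ≡ ℤ→ℚ (g k ^ m)
  power m k k<n = trans (cong (_^ℚ (2 ℕ.* m)) (F-f k k<n)) (trans (ι-^ (f k) (2 ℕ.* m))
    (cong ℤ→ℚ (trans (even-power (f k) m) (cong (_^ m) (f²-g k k<n)))))

  odd-power : ∀ m → Σ< n (λ k → ℕ→ℚ (2 ℕ.* k ℕ.+ 1) ℚ.* (F k ^ℚ (2 ℕ.* m))) ≡ ℤ→ℚ (∑ n (λ k → (+ 2 * + k + 1ℤ) * g k ^ m))
  odd-power m = Σ<-ι n (λ k → (+ 2 * + k + 1ℤ) * g k ^ m) λ k k<n →
    trans (cong₂ ℚ._*_ (ι-odd k) (power m k k<n)) (ι-* (+ 2 * + k + 1ℤ) (g k ^ m))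

  alternating-power : ∀ m → Σ< n (λ k → sgn k ℚ.* ℕ→ℚ (2 ℕ.* k ℕ.+ 1) ℚ.* (F k ^ℚ (2 ℕ.* m)))
    ≡ ℤ→ℚ (∑ n (λ k → (- 1ℤ) ^ k * (+ 2 * + k + 1ℤ) * g k ^ m))
  alternating-power m = Σ<-ι n (λ k → (- 1ℤ) ^ k * (+ 2 * + k + 1ℤ) * g k ^ m) λ k k<n → trans
    (cong₂ ℚ._*_ (trans (cong₂ ℚ._*_ (ι-^ (- 1ℤ) k) (ι-odd k)) (ι-* ((- 1ℤ) ^ k) (+ 2 * + k + 1ℤ))) (power m k k<n))
    (ι-* ((- 1ℤ) ^ k * (+ 2 * + k + 1ℤ)) (g k ^ m))

  odd-integral : Span g → ∀ m → ∃ λ y →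
    ((+ 1) ℚ./ n) ℚ.* Σ< n (λ k → ℕ→ℚ (2 ℕ.* k ℕ.+ 1) ℚ.* (F k ^ℚ (2 ℕ.* m))) ≡ ℤ→ℚ y
  odd-integral g∈ m with span-sum (λ k → + 2 * + k + 1ℤ) n (λ i → _ , odd-sum-n i n) (span-^ g∈ m)
  ... | y , eq = y , trans (cong (((+ 1) ℚ./ n) ℚ.*_) (trans (odd-power m) (cong ℤ→ℚ eq))) (1/n*ι[n*a] n y)

  alternating-integral : Span g → ∀ m → ∃ λ y →
    ((+ 1) ℚ./ n) ℚ.* Σ< n (λ k → sgn k ℚ.* ℕ→ℚ (2 ℕ.* k ℕ.+ 1) ℚ.* (F k ^ℚ (2 ℕ.* m))) ≡ ℤ→ℚ y
  alternating-integral g∈ m with span-sum (λ k → (- 1ℤ) ^ k * (+ 2 * + k + 1ℤ)) n (λ i → _ , alternating-sum i n) (span-^ g∈ m)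
  ... | y , eq = y , trans (cong (((+ 1) ℚ./ n) ℚ.*_) (trans (alternating-power m) (cong ℤ→ℚ eq))) (1/n*ι[n*a] n y)

-- From p-raise, n (n+1) p i n = (1+i) (i p i n + 2 (2i+1) p (1+i) n), and i 4ⁱ is even.
X*r : ∀ n i → ∃ λ y → + n * (1ℤ + + n) * r n i ≡ + 2 * ((1ℤ + + i) * y)
X*r n zero = p 1 n , alg (+ n * (1ℤ + + n)) (p 0 n) (p 1 n) (p-raise 0 n)
  where
  alg : ∀ X p p⁺ → + 2 * (+ 2 * 0ℤ + 1ℤ) * (1ℤ + 0ℤ) * p⁺ ≡ (X - 0ℤ * (1ℤ + 0ℤ)) * p →
    X * (1ℤ * p) ≡ + 2 * ((1ℤ + 0ℤ) * p⁺)
  alg X p p⁺ h = by (refl ⊞ - 1ℤ · h) (solve (X ∷ p ∷ p⁺ ∷ []))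
X*r n (suc i) = (+ 2) * (+ 4) ^ i * ((1ℤ + + i) * p (suc i) n + + 2 * (+ 2 * (1ℤ + + i) + 1ℤ) * p (suc (suc i)) n) ,
    alg (+ n * (1ℤ + + n)) (+ i) ((+ 4) ^ i) (p (suc i) n) (p (suc (suc i)) n) (p-raise (suc i) n)
  where
  alg : ∀ X i q p p⁺ → + 2 * (+ 2 * (1ℤ + i) + 1ℤ) * (1ℤ + (1ℤ + i)) * p⁺ ≡ (X - (1ℤ + i) * (1ℤ + (1ℤ + i))) * p →
    X * (+ 4 * q * p) ≡ + 2 * ((1ℤ + (1ℤ + i)) * (+ 2 * q * ((1ℤ + i) * p + + 2 * (+ 2 * (1ℤ + i) + 1ℤ) * p⁺)))
  alg X i q p p⁺ h = by (refl ⊞ - (+ 4 * q) · h) (solve (X ∷ i ∷ q ∷ p ∷ p⁺ ∷ []))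

module Integrality (m n : ℕ) {{_ : NonZero n}} (x : ℤ) where
  open Values (reflect x)
  open Reflection (reflect x) using (x-n) renaming (n to ν)

  module D-powers = EvenPowers n (λ k → d k (ℤ→ℚ x)) (Dq.dₙ n) (Dq.D n)
    (λ k → d-ι) (λ k k<n → Dq.Squares.square (Dq.squares n k k<n))
  module S-powers = EvenPowers n (λ k → s k (ℤ→ℚ x)) (Sq.sₙ n) (Sq.D n)
    (λ k → s-ι) (λ k k<n → Sq.Squares.square (Sq.squares n k k<n))

  D∈Span : Span (Dq.D n)
  D∈Span = span-∑ n λ i → scaled (r ν i) i λ k → *-comm (b i k) (r ν i)

  S∈Span : Span (Sq.D n)
  S∈Span = span-∑ n λ i → scaled (c i * Sq.η i) i λ k → trans (*-assoc (b i k) (c i) (Sq.η i)) (*-comm (b i k) (c i * Sq.η i))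

  P2-integral : ∃ λ y → P2 m n (ℤ→ℚ x) ≡ ℤ→ℚ y
  P2-integral = D-powers.odd-integral D∈Span m

  P3-integral : ∃ λ y → P3 m n (ℤ→ℚ x) ≡ ℤ→ℚ y
  P3-integral = D-powers.alternating-integral D∈Span m

  P5-integral : ∃ λ y → P5 m n (ℤ→ℚ x) ≡ ℤ→ℚ y
  P5-integral = S-powers.odd-integral S∈Span m

  P6-integral : ∃ λ y → P6 m n (ℤ→ℚ x) ≡ ℤ→ℚ y
  P6-integral = S-powers.alternating-integral S∈Span m

  P4-integral : ∃ λ y → P4 n (ℤ→ℚ x) ≡ ℤ→ℚ y
  P4-integral = y , (begin
    I ℚ.* I ℚ.* Σ< n (λ k → ℕ→ℚ (2 ℕ.* k ℕ.+ 1) ℚ.* (s k (ℤ→ℚ x) ^ℚ 2))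
      ≡⟨ ℚ.*-assoc I I _ ⟩
    I ℚ.* (I ℚ.* Σ< n (λ k → ℕ→ℚ (2 ℕ.* k ℕ.+ 1) ℚ.* (s k (ℤ→ℚ x) ^ℚ 2)))
      ≡⟨ cong (λ y → I ℚ.* (I ℚ.* y)) (trans (S-powers.odd-power 1) (cong ℤ→ℚ total)) ⟩
    I ℚ.* (I ℚ.* ℤ→ℚ (+ n * (+ n * y)))
      ≡⟨ cong (I ℚ.*_) (1/n*ι[n*a] n (+ n * y)) ⟩
    I ℚ.* ℤ→ℚ (+ n * y)
      ≡⟨ 1/n*ι[n*a] n y ⟩
    ℤ→ℚ y ∎)
    where
    open ≡-Reasoning
    I : ℚ
    I = (+ 1) ℚ./ n
    alg : ∀ i c t η → c ≡ (1ℤ + i) * t → c * η ≡ (1ℤ + i) * (t * η)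
    alg i c t η refl = *-assoc (1ℤ + i) t η
    divisible : ∃ λ y → ∑ n (λ k → (+ 2 * + k + 1ℤ) * ∑ n (λ i → b i k * (c i * Sq.η i))) ≡ + n * + n * y
    divisible = n²-divides n n (λ i → c i * Sq.η i) λ i → _ , alg (+ i) (c i) _ (Sq.η i) (proj₂ (catalan i))
    y : ℤ
    y = proj₁ divisible
    -- `odd-power 1` fits the exponent 2, since `2 ℕ.* 1` evaluates to 2, and leaves the trivial
    -- power `^ 1`.
    total : ∑ n (λ k → (+ 2 * + k + 1ℤ) * Sq.D n k ^ 1) ≡ + n * (+ n * y)
    total = trans (∑-cong n λ k → cong ((+ 2 * + k + 1ℤ) *_) (trans (*-identityʳ (Sq.D n k)) (∑-cong n λ i → *-assoc (b i k) (c i) (Sq.η i))))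
      (trans (proj₂ divisible) (*-assoc (+ n) (+ n) y))

  P1-integral : ∃ λ y → P1 n (ℤ→ℚ x) ≡ ℤ→ℚ y
  P1-integral = y , (begin
    ℤ→ℚ x ℚ.* (ℤ→ℚ x ℚ.+ 1ℚ) ℚ.* H ℚ.* I ℚ.* I ℚ.* Σ< n (λ k → ℕ→ℚ (2 ℕ.* k ℕ.+ 1) ℚ.* (d k (ℤ→ℚ x) ^ℚ 2))
      ≡⟨ cong₂ (λ p q → p ℚ.* H ℚ.* I ℚ.* I ℚ.* q)
           (trans (cong (ℤ→ℚ x ℚ.*_) (ι-+ x 1ℤ)) (ι-* x (x + 1ℤ))) (D-powers.odd-power 1) ⟩
    ℤ→ℚ A ℚ.* H ℚ.* I ℚ.* I ℚ.* ℤ→ℚ T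
      ≡⟨ rearrange (ℤ→ℚ A) H I (ℤ→ℚ T) ⟩
    I ℚ.* (I ℚ.* (H ℚ.* (ℤ→ℚ A ℚ.* ℤ→ℚ T)))
      ≡⟨ cong (λ y → I ℚ.* (I ℚ.* (H ℚ.* y))) (trans (ι-* A T) (cong ℤ→ℚ total)) ⟩
    I ℚ.* (I ℚ.* (H ℚ.* ℤ→ℚ (+ 2 * (+ n * (+ n * y)))))
      ≡⟨ cong (λ y → I ℚ.* (I ℚ.* y)) (1/n*ι[n*a] 2 (+ n * (+ n * y))) ⟩
    I ℚ.* (I ℚ.* ℤ→ℚ (+ n * (+ n * y)))
      ≡⟨ cong (I ℚ.*_) (1/n*ι[n*a] n (+ n * y)) ⟩
    I ℚ.* ℤ→ℚ (+ n * y)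
      ≡⟨ 1/n*ι[n*a] n y ⟩
    ℤ→ℚ y ∎)
    where
    open ≡-Reasoning
    H I : ℚ
    H = (+ 1) ℚ./ 2
    I = (+ 1) ℚ./ n
    A T : ℤ
    A = x * (x + 1ℤ)
    T = ∑ n (λ k → (+ 2 * + k + 1ℤ) * Dq.D n k ^ 1)
    rearrange : ∀ a h i t → a ℚ.* h ℚ.* i ℚ.* i ℚ.* t ≡ i ℚ.* (i ℚ.* (h ℚ.* (a ℚ.* t)))
    rearrange = Q.solve 4 (λ a h i t → a Q.:* h Q.:* i Q.:* i Q.:* t Q.:= i Q.:* (i Q.:* (h Q.:* (a Q.:* t)))) refl
      where module Q = +-*-Solver
    -- Half of x(x+1) times `r ν i`, with the factor i + 1 displayed for `n²-divides`.
    h : ℕ → ℤ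
    h i = (1ℤ + + i) * proj₁ (X*r ν i)
    divisible : ∃ λ y → ∑ n (λ k → (+ 2 * + k + 1ℤ) * ∑ n (λ i → b i k * h i)) ≡ + n * + n * y
    divisible = n²-divides n n h λ i → _ , refl
    y : ℤ
    y = proj₁ divisible
    alg : ∀ A X b r g → A ≡ X → X * r ≡ + 2 * g → A * (b * r) ≡ + 2 * (b * g)
    alg A X b r g h₁ h₂ = by (refl ⊞ b * r · h₁ ⊞ b · h₂) (solve (A ∷ X ∷ b ∷ r ∷ g ∷ []))
    A-X : A ≡ + ν * (1ℤ + + ν)
    A-X = trans (cong (x *_) (+-comm x 1ℤ)) x-n
    inner : ∀ k → A * Dq.D n k ≡ + 2 * ∑ n (λ i → b i k * h i)
    inner k = trans (∑-*ˡ n A (λ i → b i k * r ν i)) (trans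
      (∑-cong n λ i → alg A _ (b i k) (r ν i) (h i) A-X (proj₂ (X*r ν i)))
      (sym (∑-*ˡ n (+ 2) (λ i → b i k * h i))))
    algᵏ : ∀ A o D S → A * D ≡ + 2 * S → A * (o * (D * 1ℤ)) ≡ + 2 * (o * S)
    algᵏ A o D S h = by (refl ⊞ o · h) (solve (A ∷ o ∷ D ∷ S ∷ []))
    total : A * T ≡ + 2 * (+ n * (+ n * y))
    total = trans (∑-*ˡ n A (λ k → (+ 2 * + k + 1ℤ) * Dq.D n k ^ 1)) (trans
      (∑-cong n λ k → algᵏ A (+ 2 * + k + 1ℤ) (Dq.D n k) (∑ n (λ i → b i k * h i)) (inner k))
      (trans (sym (∑-*ˡ n (+ 2) (λ k → (+ 2 * + k + 1ℤ) * ∑ n (λ i → b i k * h i))))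
        (cong (+ 2 *_) (trans (proj₂ divisible) (*-assoc (+ n) (+ n) y)))))

theorem1p1 : (m n : ℕ) → .{{_ : NonZero m}} → .{{_ : NonZero n}} →
    IntegerValued (P1 n) × IntegerValued (P2 m n) × IntegerValued (P3 m n) ×
    IntegerValued (P4 n) × IntegerValued (P5 m n) × IntegerValued (P6 m n)
-- Matching on `suc` provides the relevant instance of `NonZero n` that `Integrality` takes.
theorem1p1 m n@(suc _) =
  (λ x → Integrality.P1-integral m n x) , (λ x → Integrality.P2-integral m n x) , (λ x → Integrality.P3-integral m n x) ,
  (λ x → Integrality.P4-integral m n x) , (λ x → Integrality.P5-integral m n x) , (λ x → Integrality.P6-integral m n x)
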